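{- Let $N$ be a finite set with $|N|\geq 2$ and let $\mathcal{S}$ be a non-trivial set system on $N$. Then $\mathcal{S}$ is semi-balanced if and only if $\mathcal{S}^{\star}$ is semi-balanced, and $\Theta_{\mathcal{S}^{\star}}=\{\theta^{\star}:\theta\in\Theta_{\mathcal{S}}\}$. Likewise, $\mathcal{S}$ is balanced if and only if $\mathcal{S}^{\star}$ is balanced. In particular, $\mathcal{S}$ is min-semi-balanced if and only if $\mathcal{S}^{\star}$ is min-semi-balanced, and $\mathcal{S}$ is min-balanced if and only if $\mathcal{S}^{\star}$ is min-balanced; if $\mathcal{S}$ is min-semi-balanced then $(\theta_{\mathcal{S}})^{\star}=\theta_{\mathcal{S}^{\star}}$. Moreover, given $\theta\in\mathbb{R}^{\mathcal{P}(N)}$ with $\sum_{S\subseteq N}\theta(S)=0$ and $\sum_{L:\,\emptyset\neq L\subset N}\theta(L)=-1$, the inequality $0\leq\langle\theta,m\rangle$ is facet-defining for $\mathcal{E}(N)$ if and only if its conjugate inequality $0\leq\langle\theta^{\star},m\rangle$ is facet-defining for $\mathcal{E}(N)$.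
   Context: $\mathcal{P}(N)$ is the power set of $N$, $\subset$ is strict inclusion, and $\chi_S\in\mathbb{R}^N$ is the incidence vector of $S\subseteq N$. A constant vector in $\mathbb{R}^N$ is a vector $[r,\ldots,r]$, $r\in\mathbb{R}$. A linear combination is affine if its coefficients sum to $1$, conic if all coefficients are $\geq 0$, and semi-conic if at most one coefficient is strictly negative. A non-trivial set system on $N$ is a system $\mathcal{S}$ with $\emptyset\neq\mathcal{S}\subseteq\mathcal{P}(N)\setminus\{\emptyset,N\}$. It is balanced (on $N$) if $\chi_N$ is a conic combination of $\{\chi_S:S\in\mathcal{S}\}$ with all coefficients non-zero. It is semi-balanced (on $N$) if some constant vector in $\mathbb{R}^N$ is a semi-conic combination of $\{\chi_S:S\in\mathcal{S}\}$ with all coefficients non-zero. It is min-balanced (min-semi-balanced) if it is balanced (semi-balanced) and has no strict subsystem that is balanced (semi-balanced) on $N$. The complementary system is $\mathcal{S}^{\star}:=\{N\setminus S:S\in\mathcal{S}\}$. For $\theta\in\mathbb{R}^{\mathcal{P}(N)}$ put $\theta^{\star}(L):=\theta(N\setminus L)$, $L\subseteq N$. For a non-trivial set system $\mathcal{S}$ on $N$, any affine semi-conic combination $\sum_{S\in\mathcal{S}}\lambda_S\chi_S$ (zero coefficients allowed) yielding a constant vector $[r,\ldots,r]$ is assigned the vector $\theta\in\mathbb{R}^{\mathcal{P}(N)}$ with $\theta(S)=-\lambda_S$ for $S\in\mathcal{S}$, $\theta(N)=r$, $\theta(\emptyset)=1-r$, and $\theta(L)=0$ for other $L\subseteq N$.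 $\Theta_{\mathcal{S}}$ is the set of all such $\theta$. If $|\Theta_{\mathcal{S}}|=1$ (which holds for min-semi-balanced $\mathcal{S}$), its only element is $\theta_{\mathcal{S}}$. A game over $N$ is $m\in\mathbb{R}^{\mathcal{P}(N)}$ with $m(\emptyset)=0$. Its core is $C(m)=\{x\in\mathbb{R}^N:\sum_{i\in N}x_i=m(N),\ \sum_{i\in S}x_i\geq m(S)\ \forall S\subseteq N\}$. The game $m$ is exact if for each $S\subseteq N$ there is $x\in C(m)$ with $\sum_{i\in S}x_i=m(S)$. $\mathcal{E}(N)$ is the polyhedral cone of exact games, full-dimensional when regarded in $\mathbb{R}^{\mathcal{P}(N)\setminus\{\emptyset\}}$. Write $\langle\theta,m\rangle=\sum_{S\subseteq N}\theta(S)m(S)$. The inequality $0\leq\langle\theta,m\rangle$ is facet-defining for $\mathcal{E}(N)$ if it is valid on $\mathcal{E}(N)$ and $\{m\in\mathcal{E}(N):\langle\theta,m\rangle=0\}$ is a face of dimension $\dim\mathcal{E}(N)-1$. -}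

module Defs where

open import Algebra.Bundles using (CommutativeRing)
open import Data.Bool.Base using (Bool; true; not; T; if_then_else_; _∧_)
open import Data.Bool.Properties using (not-involutive)
open import Data.Fin.Base using (Fin)
open import Data.Fin.Subset using (Subset; inside; outside; ⊤; ⊥; ∁)
open import Data.Fin.Subset.Properties using (nonempty?; _⊂?_)
open import Data.Nat.Base using (ℕ; zero; suc)
open import Data.Product.Base using (_×_; _,_; ∃; ∃-syntax)
open import Data.Vec.Base using ([]; _∷_; lookup)
open import Function.Base using (const)
open import Function.Bundles using (_⇔_; mk⇔)
open import Level using (0ℓ)
open import Relation.Binary.Core using (Rel)
open import Relation.Binary.PropositionalEquality
  using (_≡_; _≢_; refl; sym; subst; cong₂)
open import Relation.Binary.Structures using (IsDecTotalOrder)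
open import Relation.Nullary using (¬_; does)
open import Relation.Unary using (Pred; _∈_; _∩_; Satisfiable)

-- The field of real numbers, given by its classical axioms, which determine
-- it up to isomorphism. Decidability of the order is the classical reading of
-- trichotomy.
record CompleteOrderedField : Set₁ where
  field
    commutativeRing : CommutativeRing 0ℓ 0ℓ
  open CommutativeRing commutativeRing public
    renaming (refl to ≈-refl; sym to ≈-sym; trans to ≈-trans)
  infix 4 _≤_ _<_
  field
    _≤_             : Rel Carrier 0ℓ
    isDecTotalOrder : IsDecTotalOrder _≈_ _≤_
    +-monoˡ-≤       : ∀ z {x y} → x ≤ y → x + z ≤ y + z
    *-nonneg        : ∀ {x y} → 0# ≤ x → 0# ≤ y → 0# ≤ x * y
    0≉1             : ¬ (0# ≈ 1#)
    inverse         : ∀ x → ¬ (x ≈ 0#) → ∃[ y ] x * y ≈ 1#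

  _<_ : Rel Carrier 0ℓ
  x < y = x ≤ y × ¬ (x ≈ y)

  UpperBound : Pred Carrier 0ℓ → Pred Carrier 0ℓ
  UpperBound P b = ∀ x → x ∈ P → x ≤ b

  field
    supremum : ∀ P → Satisfiable P → Satisfiable (UpperBound P) →
               ∃[ s ] (s ∈ UpperBound P × (∀ b → b ∈ UpperBound P → s ≤ b))

-- A system of subsets of Fin n; classically every such system has a
-- Boolean-valued membership function.
SetSystem : ℕ → Set
SetSystem n = Subset n → Bool

infix 4 _∈ₛ_ _⊊ₛ_
_∈ₛ_ : ∀ {n} → Subset n → SetSystem n → Set
L ∈ₛ 𝒮 = T (𝒮 L)

_⊊ₛ_ : ∀ {n} → SetSystem n → SetSystem n → Set
𝒯 ⊊ₛ 𝒮 = (∀ L → L ∈ₛ 𝒯 → L ∈ₛ 𝒮) × (∃[ L ] (L ∈ₛ 𝒮 × ¬ (L ∈ₛ 𝒯)))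

allSubsets : ∀ {n} → SetSystem n
allSubsets = const true

properSubsets : ∀ {n} → SetSystem n
properSubsets L = does (nonempty? L) ∧ does (L ⊂? ⊤)

NonTrivial : ∀ {n} → SetSystem n → Set
NonTrivial 𝒮 = (∃[ L ] L ∈ₛ 𝒮) × ¬ (⊥ ∈ₛ 𝒮) × ¬ (⊤ ∈ₛ 𝒮)

infix 8 _⋆
_⋆ : ∀ {n} → SetSystem n → SetSystem n
(𝒮 ⋆) L = 𝒮 (∁ L)

∁-involutive : ∀ {n} (L : Subset n) → ∁ (∁ L) ≡ L
∁-involutive []      = refl
∁-involutive (b ∷ L) = cong₂ _∷_ (not-involutive b) (∁-involutive L)

-- 𝒮 ⋆ = { N ∖ S : S ∈ 𝒮 }
∈⋆⇔ : ∀ {n} (𝒮 : SetSystem n) (L : Subset n) →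
      L ∈ₛ 𝒮 ⋆ ⇔ (∃[ S ] (S ∈ₛ 𝒮 × L ≡ ∁ S))
∈⋆⇔ 𝒮 L = mk⇔
  (λ L∈ → ∁ L , L∈ , sym (∁-involutive L))
  (λ { (S , S∈ , refl) → subst (_∈ₛ 𝒮) (sym (∁-involutive S)) S∈ })

module Sums (ℝ : CompleteOrderedField) where
  open CompleteOrderedField ℝ
  open import Algebra.Properties.Monoid.Sum +-monoid public using (sum)

  sumPowerset : ∀ n → (Subset n → Carrier) → Carrier
  sumPowerset zero    f = f []
  sumPowerset (suc n) f = sumPowerset n (λ L → f (outside ∷ L))
                        + sumPowerset n (λ L → f (inside ∷ L))

  sumOver : ∀ {n} → SetSystem n → (Subset n → Carrier) → Carrier
  sumOver {n} 𝒮 f = sumPowerset n (λ L → if 𝒮 L then f L else 0#)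

  infix 6 sumOver
  syntax sumOver 𝒮 (λ L → e) = ∑[ L ∈ 𝒮 ] e

-- Throughout, N = Fin n.
module Games (ℝ : CompleteOrderedField) (n : ℕ) where
  open CompleteOrderedField ℝ public
    using (Carrier; _≈_; _≤_; _<_; _+_; _*_; _-_; -_; 0#; 1#)
  open Sums ℝ public

  ℝᴺ ℝᴾ : Set
  ℝᴺ = Fin n → Carrier
  ℝᴾ = Subset n → Carrier

  infix 4 _≋_
  _≋_ : ℝᴾ → ℝᴾ → Set
  θ ≋ η = ∀ L → θ L ≈ η L

  infix 8 _⋆ᵛ
  _⋆ᵛ : ℝᴾ → ℝᴾ
  (θ ⋆ᵛ) L = θ (∁ L)

  ⟨_,_⟩ : ℝᴾ → ℝᴾ → Carrier
  ⟨ θ , m ⟩ = ∑[ S ∈ allSubsets ] θ S * m S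

  χ : Subset n → ℝᴺ
  χ S i = if lookup S i then 1# else 0#

  -- In a combination of { χ S : S ∈ 𝒮 } with coefficients c, the values of c
  -- outside 𝒮 are irrelevant.

  combination : SetSystem n → ℝᴾ → ℝᴺ
  combination 𝒮 c i = ∑[ S ∈ 𝒮 ] c S * χ S i

  Affine Conic SemiConic AllNonZero : SetSystem n → ℝᴾ → Set
  Affine     𝒮 c = ∑[ S ∈ 𝒮 ] c S ≈ 1#
  Conic      𝒮 c = ∀ S → S ∈ₛ 𝒮 → 0# ≤ c S
  SemiConic  𝒮 c = ∀ S S′ → S ∈ₛ 𝒮 → S′ ∈ₛ 𝒮 → c S < 0# → c S′ < 0# → S ≡ S′
  AllNonZero 𝒮 c = ∀ S → S ∈ₛ 𝒮 → ¬ (c S ≈ 0#)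

  YieldsConstant : SetSystem n → ℝᴾ → Carrier → Set
  YieldsConstant 𝒮 c r = ∀ i → combination 𝒮 c i ≈ r

  Balanced SemiBalanced MinBalanced MinSemiBalanced : SetSystem n → Set
  Balanced 𝒮 = NonTrivial 𝒮 × (∃[ c ]
    (Conic 𝒮 c × AllNonZero 𝒮 c × (∀ i → combination 𝒮 c i ≈ χ ⊤ i)))
  SemiBalanced 𝒮 = NonTrivial 𝒮 × (∃[ c ] ∃[ r ]
    (SemiConic 𝒮 c × AllNonZero 𝒮 c × YieldsConstant 𝒮 c r))
  MinBalanced     𝒮 = Balanced 𝒮 × (∀ 𝒯 → 𝒯 ⊊ₛ 𝒮 → ¬ Balanced 𝒯)
  MinSemiBalanced 𝒮 = SemiBalanced 𝒮 × (∀ 𝒯 → 𝒯 ⊊ₛ 𝒮 → ¬ SemiBalanced 𝒯)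

  record AssignedTo (𝒮 : SetSystem n) (c : ℝᴾ) (r : Carrier) (θ : ℝᴾ) : Set where
    field
      on-𝒮      : ∀ S → S ∈ₛ 𝒮 → θ S ≈ - c S
      on-N      : θ ⊤ ≈ r
      on-∅      : θ ⊥ ≈ 1# - r
      elsewhere : ∀ L → ¬ (L ∈ₛ 𝒮) → L ≢ ⊤ → L ≢ ⊥ → θ L ≈ 0#

  Θ : SetSystem n → Pred ℝᴾ 0ℓ
  Θ 𝒮 θ = ∃[ c ] ∃[ r ]
    (Affine 𝒮 c × SemiConic 𝒮 c × YieldsConstant 𝒮 c r × AssignedTo 𝒮 c r θ)

  infix 4 _isOnlyElementOf_
  _isOnlyElementOf_ : ℝᴾ → Pred ℝᴾ 0ℓ → Set
  θ isOnlyElementOf X = θ ∈ X × (∀ η → η ∈ X → η ≋ θ)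

  total : ℝᴺ → Subset n → Carrier
  total x S = sum (λ i → if lookup S i then x i else 0#)

  Game : Pred ℝᴾ 0ℓ
  Game m = m ⊥ ≈ 0#

  Core : ℝᴾ → Pred ℝᴺ 0ℓ
  Core m x = sum x ≈ m ⊤ × (∀ S → m S ≤ total x S)

  -- The cone ℰ(N) of exact games.
  Exact : Pred ℝᴾ 0ℓ
  Exact m = Game m × (∀ S → ∃[ x ] (x ∈ Core m × total x S ≈ m S))

  AffineCombinationOf : ∀ {k} → (Fin k → ℝᴾ) → Pred ℝᴾ 0ℓ
  AffineCombinationOf p v =
    ∃[ c ] (sum c ≈ 1# × (∀ L → v L ≈ sum (λ i → c i * p i L)))

  AffineHull : Pred ℝᴾ 0ℓ → Pred ℝᴾ 0ℓ
  AffineHull X v =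
    ∃[ k ] ∃ λ (p : Fin k → ℝᴾ) → (∀ i → p i ∈ X) × v ∈ AffineCombinationOf p

  AffinelyIndependent : ∀ {k} → (Fin k → ℝᴾ) → Set
  AffinelyIndependent p = ∀ c → sum c ≈ 0# →
    (∀ L → sum (λ i → c i * p i L) ≈ 0#) → ∀ i → c i ≈ 0#

  -- The affine hull of X has an affine basis of d + 1 points.
  HasDimension : Pred ℝᴾ 0ℓ → ℕ → Set
  HasDimension X d = ∃ λ (p : Fin (suc d) → ℝᴾ) →
    (∀ i → p i ∈ AffineHull X) × AffinelyIndependent p ×
    (∀ v → v ∈ AffineHull X → v ∈ AffineCombinationOf p)

  -- Validity makes { m ∈ Exact : ⟨ θ , m ⟩ = 0 } a face of Exact.
  FacetDefining : ℝᴾ → Set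
  FacetDefining θ =
    (∀ m → m ∈ Exact → 0# ≤ ⟨ θ , m ⟩) ×
    (∃[ d ] (HasDimension Exact (suc d) ×
             HasDimension (Exact ∩ (λ m → ⟨ θ , m ⟩ ≈ 0#)) d))

{-# OPTIONS --safe #-}

-- If ∑ c S χ S is the constant r, then ∑ c S χ (N ∖ S) is the constant ∑ c S - r.
-- In the balanced case the new constant is positive, being at least any
-- coefficient of a set containing a fixed element.
--
-- In a min-semi-balanced system a semi-conic combination that yields a constant
-- and has one zero coefficient has only zero coefficients, since otherwise its
-- support would be a smaller semi-balanced system. Given two affine combinations
-- c and d one can choose ρ as the least ratio d S / c S such that d - ρ c is
-- semi-conic with a zero coefficient; hence d = ρ c, and ρ = 1.
--
-- For facets, m ↦ m † with m † (S) = m (N ∖ S) - m (N) is a linear involution on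
-- games, the core of m † is the negative of the core of m, and
-- ⟨ θ , m † ⟩ = ⟨ θ ⋆ᵛ , m ⟩ whenever the entries of θ sum to zero.
module Submission where

open import Defs
open import Data.Bool.Base using (true; false; not; T; if_then_else_; _∧_)
open import Data.Bool.Properties using (T-∧; T?) renaming (_≟_ to _≟ᵇ_)
open import Data.Empty using (⊥-elim) renaming (⊥ to Empty)
open import Data.Fin.Base using (Fin)
import Data.Fin.Base as Fin
open import Data.Fin.Subset using (Subset; inside; outside; ⊤; ⊥; ∁)
open import Data.Fin.Subset.Properties using (anySubset?)
open import Data.Nat.Base using (ℕ; zero; suc) renaming (_≤_ to _≤ℕ_)
open import Data.Product.Base using (_×_; _,_; proj₁; proj₂; ∃-syntax)
open import Data.Sum.Base using (_⊎_; inj₁; inj₂)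
open import Data.Vec.Base using ([]; _∷_; lookup)
open import Data.Vec.Properties using (≡-dec; lookup-map; lookup-replicate; map-replicate)
open import Function.Base using (_∘_)
open import Function.Bundles using (_⇔_; mk⇔; Equivalence)
open import Level using (0ℓ)
open import Relation.Binary.Definitions using (DecidableEquality) renaming (Decidable to Decidable₂)
open import Relation.Binary.PropositionalEquality as ≡ using (_≡_; _≢_; cong; subst)
open import Relation.Binary.Structures using (IsDecTotalOrder)
open import Relation.Nullary using (¬_; yes; no; contradiction)
open import Relation.Nullary.Decidable using (isYes; ¬?; _×-dec_; decidable-stable; toWitness; fromWitness)
open import Relation.Unary using (Pred; _∈_; Decidable; Satisfiable)

-- Subsets, complements and conjugate set systems.

infix 4 _≟ˢ_
_≟ˢ_ : ∀ {n} → DecidableEquality (Subset n)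
_≟ˢ_ = ≡-dec _≟ᵇ_

≢⇒lookup≢ : ∀ {n} (S L : Subset n) → S ≢ L → ∃[ i ] lookup S i ≢ lookup L i
≢⇒lookup≢ []      []      S≢L = contradiction ≡.refl S≢L
≢⇒lookup≢ (a ∷ S) (b ∷ L) S≢L with a ≟ᵇ b
... | no a≢b = Fin.zero , a≢b
... | yes ≡.refl with ≢⇒lookup≢ S L (S≢L ∘ cong (a ∷_))
...   | i , Si≢Li = Fin.suc i , Si≢Li

≢⊤⇒outside : ∀ {n} (S : Subset n) → S ≢ ⊤ → ∃[ i ] lookup S i ≡ outside
≢⊤⇒outside {n} S S≢⊤ with ≢⇒lookup≢ S ⊤ S≢⊤
... | i , Si≢ with lookup S i in eq
...   | false = i , eq
...   | true  = contradiction (≡.sym (lookup-replicate i true)) Si≢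

≢⊥⇒inside : ∀ {n} (S : Subset n) → S ≢ ⊥ → ∃[ i ] lookup S i ≡ inside
≢⊥⇒inside {n} S S≢⊥ with ≢⇒lookup≢ S ⊥ S≢⊥
... | i , Si≢ with lookup S i in eq
...   | true  = i , eq
...   | false = contradiction (≡.sym (lookup-replicate i false)) Si≢

∁⊤≡⊥ : ∀ n → ∁ (⊤ {n}) ≡ ⊥
∁⊤≡⊥ n = map-replicate not true n

∁⊥≡⊤ : ∀ n → ∁ (⊥ {n}) ≡ ⊤
∁⊥≡⊤ n = map-replicate not false n

∁-injective : ∀ {n} {S L : Subset n} → ∁ S ≡ ∁ L → S ≡ L
∁-injective {S = S} {L} eq =
  ≡.trans (≡.sym (∁-involutive S)) (≡.trans (cong ∁ eq) (∁-involutive L))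

-- A symmetric relation in place of the operation `_⋆`: since `𝒮 ⋆ ⋆` is not definitionally `𝒮`, one
-- lemma about a conjugate pair thus serves both directions of an equivalence. Being a record, it
-- lets both systems be inferred.
record Conjugate {n} (𝒮 𝒯 : SetSystem n) : Set where
  constructor conjugate
  field
    pointwise : ∀ L → 𝒯 L ≡ 𝒮 (∁ L)

conjugate-sym : ∀ {n} {𝒮 𝒯 : SetSystem n} → Conjugate 𝒮 𝒯 → Conjugate 𝒯 𝒮
conjugate-sym {𝒮 = 𝒮} (conjugate 𝒯≡) = conjugate λ L →
  ≡.trans (cong 𝒮 (≡.sym (∁-involutive L))) (≡.sym (𝒯≡ (∁ L)))

conjugate-⋆ : ∀ {n} (𝒮 : SetSystem n) → Conjugate 𝒮 (𝒮 ⋆)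
conjugate-⋆ 𝒮 = conjugate λ L → ≡.refl

∁-∈ : ∀ {n} {𝒮 𝒯 : SetSystem n} → Conjugate 𝒮 𝒯 → ∀ L → L ∈ₛ 𝒯 → ∁ L ∈ₛ 𝒮
∁-∈ (conjugate 𝒯≡) L = subst T (𝒯≡ L)

nonTrivial-conjugate : ∀ {n} {𝒮 𝒯 : SetSystem n} → Conjugate 𝒮 𝒯 →
  NonTrivial 𝒮 → NonTrivial 𝒯
nonTrivial-conjugate {n} {𝒮} conj ((L , L∈) , ⊥∉ , ⊤∉) =
  (∁ L , ∁-∈ (conjugate-sym conj) L L∈) ,
  (λ ⊥∈ → ⊤∉ (subst (_∈ₛ 𝒮) (∁⊥≡⊤ n) (∁-∈ conj ⊥ ⊥∈))) ,
  (λ ⊤∈ → ⊥∉ (subst (_∈ₛ 𝒮) (∁⊤≡⊥ n) (∁-∈ conj ⊤ ⊤∈)))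

⊊ₛ-conjugate : ∀ {n} {𝒮 𝒯 𝒰 : SetSystem n} → Conjugate 𝒮 𝒯 → 𝒰 ⊊ₛ 𝒯 → 𝒰 ⋆ ⊊ₛ 𝒮
⊊ₛ-conjugate {𝒮 = 𝒮} {𝒰 = 𝒰} conj (𝒰⊆𝒯 , L , L∈ , L∉) =
  (λ S S∈ → subst (_∈ₛ 𝒮) (∁-involutive S) (∁-∈ conj (∁ S) (𝒰⊆𝒯 (∁ S) S∈))) ,
  ∁ L , ∁-∈ conj L L∈ , L∉ ∘ subst (_∈ₛ 𝒰) (∁-involutive L)

-- Arithmetic and order in the real field.

module OrderedField (ℝ : CompleteOrderedField) where
  open CompleteOrderedField ℝ
  open IsDecTotalOrder isDecTotalOrder public
    using (_≟_; _≤?_; antisym; ≤-respˡ-≈; ≤-respʳ-≈)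
    renaming (refl to ≤-refl; trans to ≤-trans; reflexive to ≤-reflexive; total to ≤-total)
  open import Algebra.Properties.Ring ring public
    using (-‿distribˡ-*; -‿distribʳ-*; -0#≈0#; -‿involutive; -1*x≈-x)
  open import Relation.Binary.Reasoning.Setoid setoid

  x+y≈z⇒x≈z-y : ∀ {x y z} → x + y ≈ z → x ≈ z - y
  x+y≈z⇒x≈z-y {x} {y} {z} eq = begin
    x               ≈⟨ +-identityʳ x ⟨
    x + 0#          ≈⟨ +-congˡ (-‿inverseʳ y) ⟨
    x + (y - y)     ≈⟨ +-assoc x y (- y) ⟨
    x + y - y       ≈⟨ +-congʳ eq ⟩
    z - y           ∎

  x-y+y≈x : ∀ x y → x - y + y ≈ x
  x-y+y≈x x y = begin
    x - y + y       ≈⟨ +-assoc x (- y) y ⟩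
    x + (- y + y)   ≈⟨ +-congˡ (-‿inverseˡ y) ⟩
    x + 0#          ≈⟨ +-identityʳ x ⟩
    x               ∎

  x-y≈0⇒x≈y : ∀ {x y} → x - y ≈ 0# → x ≈ y
  x-y≈0⇒x≈y {x} {y} eq = begin
    x               ≈⟨ x-y+y≈x x y ⟨
    x - y + y       ≈⟨ +-congʳ eq ⟩
    0# + y          ≈⟨ +-identityˡ y ⟩
    y               ∎

  y-[y-x]≈x : ∀ y x → y - (y - x) ≈ x
  y-[y-x]≈x y x = ≈-sym (x+y≈z⇒x≈z-y (≈-trans (+-comm x (y - x)) (x-y+y≈x y x)))

  ≈-respects-≤ : ∀ {x x′ y y′} → x ≈ x′ → y ≈ y′ → x ≤ y → x′ ≤ y′
  ≈-respects-≤ x≈x′ y≈y′ = ≤-respˡ-≈ x≈x′ ∘ ≤-respʳ-≈ y≈y′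

  +-mono-≤ : ∀ {x y u v} → x ≤ y → u ≤ v → x + u ≤ y + v
  +-mono-≤ {x} {y} {u} {v} x≤y u≤v = ≤-trans (+-monoˡ-≤ u x≤y)
    (≈-respects-≤ (+-comm u y) (+-comm v y) (+-monoˡ-≤ y u≤v))

  +-nonneg : ∀ {x y} → 0# ≤ x → 0# ≤ y → 0# ≤ x + y
  +-nonneg 0≤x 0≤y = ≤-respˡ-≈ (+-identityˡ 0#) (+-mono-≤ 0≤x 0≤y)

  x≤x+nonneg : ∀ {x y} → 0# ≤ y → x ≤ x + y
  x≤x+nonneg {x} 0≤y = ≤-respˡ-≈ (+-identityʳ x) (+-mono-≤ ≤-refl 0≤y)

  x≤nonneg+x : ∀ {x y} → 0# ≤ y → x ≤ y + x
  x≤nonneg+x {x} 0≤y = ≤-respˡ-≈ (+-identityˡ x) (+-mono-≤ 0≤y ≤-refl)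

  x≤y⇒0≤y-x : ∀ {x y} → x ≤ y → 0# ≤ y - x
  x≤y⇒0≤y-x {x} x≤y = ≤-respˡ-≈ (-‿inverseʳ x) (+-monoˡ-≤ (- x) x≤y)

  ≤0⇒0≤- : ∀ {x} → x ≤ 0# → 0# ≤ - x
  ≤0⇒0≤- {x} x≤0 = ≤-respʳ-≈ (+-identityˡ (- x)) (x≤y⇒0≤y-x x≤0)

  0≤⇒-≤0 : ∀ {x} → 0# ≤ x → - x ≤ 0#
  0≤⇒-≤0 {x} 0≤x = ≈-respects-≤ (+-identityˡ (- x)) (-‿inverseʳ x) (+-monoˡ-≤ (- x) 0≤x)

  0≤1 : 0# ≤ 1#
  0≤1 with ≤-total 0# 1#
  ... | inj₁ 0≤1 = 0≤1
  -- Even in this case `1#` is nonnegative, being the square of `- 1#`.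
  ... | inj₂ 1≤0 = ≤-respʳ-≈ [-1]²≈1 (*-nonneg (≤0⇒0≤- 1≤0) (≤0⇒0≤- 1≤0))
    where
    [-1]²≈1 : - 1# * - 1# ≈ 1#
    [-1]²≈1 = begin
      - 1# * - 1#     ≈⟨ -‿distribˡ-* 1# (- 1#) ⟨
      - (1# * - 1#)   ≈⟨ -‿cong (*-identityˡ (- 1#)) ⟩
      - - 1#          ≈⟨ -‿involutive 1# ⟩
      1#              ∎

  ≮0⇒0≤ : ∀ {x} → ¬ (x < 0#) → 0# ≤ x
  ≮0⇒0≤ {x} x≮0 with ≤-total 0# x
  ... | inj₁ 0≤x = 0≤x
  ... | inj₂ x≤0 with x ≟ 0#
  ...   | yes x≈0 = ≤-reflexive (≈-sym x≈0)
  ...   | no  x≉0 = contradiction (x≤0 , x≉0) x≮0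

  <⇒≱ : ∀ {x y} → x < y → ¬ (y ≤ x)
  <⇒≱ (x≤y , x≉y) y≤x = x≉y (antisym x≤y y≤x)

  <-≤-trans : ∀ {x y z} → x < y → y ≤ z → x < z
  <-≤-trans (x≤y , x≉y) y≤z =
    ≤-trans x≤y y≤z , λ x≈z → x≉y (antisym x≤y (≤-respʳ-≈ (≈-sym x≈z) y≤z))

  0≤∧≉0⇒0< : ∀ {x} → 0# ≤ x → ¬ (x ≈ 0#) → 0# < x
  0≤∧≉0⇒0< 0≤x x≉0 = 0≤x , x≉0 ∘ ≈-sym

  infix 4 _<?_
  _<?_ : Decidable₂ _<_
  x <? y = x ≤? y ×-dec ¬? (x ≟ y)

  -- Made total by the value `0#` at zero, so that ratios of coefficients form a function on all
  -- subsets.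
  recip : Carrier → Carrier
  recip x with x ≟ 0#
  ... | yes _   = 0#
  ... | no  x≉0 = proj₁ (inverse x x≉0)

  *-recip : ∀ {x} → ¬ (x ≈ 0#) → x * recip x ≈ 1#
  *-recip {x} x≉0 with x ≟ 0#
  ... | yes x≈0 = contradiction x≈0 x≉0
  ... | no  x≉0 = proj₂ (inverse x x≉0)

  recip-* : ∀ {x} → ¬ (x ≈ 0#) → recip x * x ≈ 1#
  recip-* {x} x≉0 = ≈-trans (*-comm (recip x) x) (*-recip x≉0)

  *-≉0 : ∀ {x y} → ¬ (x ≈ 0#) → ¬ (y ≈ 0#) → ¬ (x * y ≈ 0#)
  *-≉0 {x} {y} x≉0 y≉0 xy≈0 = y≉0 (begin
    y                   ≈⟨ *-identityˡ y ⟨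
    1# * y              ≈⟨ *-congʳ (recip-* x≉0) ⟨
    recip x * x * y     ≈⟨ *-assoc (recip x) x y ⟩
    recip x * (x * y)   ≈⟨ *-congˡ xy≈0 ⟩
    recip x * 0#        ≈⟨ zeroʳ (recip x) ⟩
    0#                  ∎)

  recip-pos : ∀ {x} → 0# < x → 0# < recip x
  recip-pos {x} (0≤x , 0≉x) = 0≤∧≉0⇒0< (≮0⇒0≤ ≮0) recip≉0
    where
    x≉0 : ¬ (x ≈ 0#)
    x≉0 = 0≉x ∘ ≈-sym
    recip≉0 : ¬ (recip x ≈ 0#)
    recip≉0 eq = 0≉1 (begin
      0#            ≈⟨ zeroʳ x ⟨
      x * 0#        ≈⟨ *-congˡ eq ⟨
      x * recip x   ≈⟨ *-recip x≉0 ⟩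
      1#            ∎)
    ≮0 : ¬ (recip x < 0#)
    -- A negative reciprocal would make `x * - recip x`, which is `- 1#`, nonnegative; adding `1#`
    -- gives `1# ≤ 0#`.
    ≮0 (recip≤0 , _) = 0≉1 (antisym 0≤1 (≈-respects-≤
      (+-identityˡ 1#)
      (≈-trans (+-congʳ x*-recip≈-1) (-‿inverseˡ 1#))
      (+-monoˡ-≤ 1# (*-nonneg 0≤x (≤0⇒0≤- recip≤0)))))
      where
      x*-recip≈-1 : x * - recip x ≈ - 1#
      x*-recip≈-1 = ≈-trans (≈-sym (-‿distribʳ-* x (recip x))) (-‿cong (*-recip x≉0))

  -- Recursion on the first coordinate: `anySubset?` decides which halves of the powerset meet `P`,
  -- the recursion enters only those, and two minima are compared.
  argmin : ∀ {n} {P : Pred (Subset n) 0ℓ} → Decidable P → (f : Subset n → Carrier) →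
    Satisfiable P → ∃[ S ] (S ∈ P × (∀ L → L ∈ P → f S ≤ f L))
  argmin {zero} P? f ([] , p) = [] , p , λ { [] _ → ≤-refl }
  argmin {suc n} {P} P? f (S , p)
    with anySubset? (P? ∘ (outside ∷_)) | anySubset? (P? ∘ (inside ∷_))
  ... | no ∄o | no ∄i = ⊥-elim (empty S p)
    where
    empty : ∀ S → ¬ P S
    empty (false ∷ S) p = ∄o (S , p)
    empty (true  ∷ S) p = ∄i (S , p)
  ... | yes ∃o | no ∄i with argmin (P? ∘ (outside ∷_)) (f ∘ (outside ∷_)) ∃o
  ...   | A , a , minA = outside ∷ A , a , λ
    { (false ∷ L) → minA L ; (true ∷ L) l → ⊥-elim (∄i (L , l)) }
  argmin {suc n} {P} P? f (S , p) | no ∄o | yes ∃i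
    with argmin (P? ∘ (inside ∷_)) (f ∘ (inside ∷_)) ∃i
  ...   | B , b , minB = inside ∷ B , b , λ
    { (false ∷ L) l → ⊥-elim (∄o (L , l)) ; (true ∷ L) → minB L }
  argmin {suc n} {P} P? f (S , p) | yes ∃o | yes ∃i
    with argmin (P? ∘ (outside ∷_)) (f ∘ (outside ∷_)) ∃o
       | argmin (P? ∘ (inside ∷_)) (f ∘ (inside ∷_)) ∃i
  ... | A , a , minA | B , b , minB with ≤-total (f (outside ∷ A)) (f (inside ∷ B))
  ...   | inj₁ A≤B = outside ∷ A , a , λ
    { (false ∷ L) → minA L ; (true ∷ L) l → ≤-trans A≤B (minB L l) }
  ...   | inj₂ B≤A = inside ∷ B , b , λ
    { (false ∷ L) l → ≤-trans B≤A (minA L l) ; (true ∷ L) → minB L }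

-- Finite sums over the powerset and over set systems.

module PowersetSums (ℝ : CompleteOrderedField) where
  open CompleteOrderedField ℝ
  open OrderedField ℝ
  open Sums ℝ
  open import Algebra.Properties.CommutativeSemigroup +-commutativeSemigroup
    using (interchange)
  open import Relation.Binary.Reasoning.Setoid setoid

  sumPowerset-cong : ∀ n {f g : Subset n → Carrier} → (∀ L → f L ≈ g L) →
    sumPowerset n f ≈ sumPowerset n g
  sumPowerset-cong zero    f≈g = f≈g []
  sumPowerset-cong (suc n) f≈g =
    +-cong (sumPowerset-cong n (f≈g ∘ (outside ∷_))) (sumPowerset-cong n (f≈g ∘ (inside ∷_)))

  sumPowerset-+ : ∀ n (f g : Subset n → Carrier) →
    sumPowerset n (λ L → f L + g L) ≈ sumPowerset n f + sumPowerset n g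
  sumPowerset-+ zero    f g = ≈-refl
  sumPowerset-+ (suc n) f g = ≈-trans
    (+-cong (sumPowerset-+ n (f ∘ (outside ∷_)) (g ∘ (outside ∷_)))
            (sumPowerset-+ n (f ∘ (inside ∷_)) (g ∘ (inside ∷_))))
    (interchange _ _ _ _)

  sumPowerset-*ˡ : ∀ n a (f : Subset n → Carrier) →
    sumPowerset n (λ L → a * f L) ≈ a * sumPowerset n f
  sumPowerset-*ˡ zero    a f = ≈-refl
  sumPowerset-*ˡ (suc n) a f = ≈-trans
    (+-cong (sumPowerset-*ˡ n a (f ∘ (outside ∷_))) (sumPowerset-*ˡ n a (f ∘ (inside ∷_))))
    (≈-sym (distribˡ a _ _))

  -- Complementation swaps the subsets without and with the first element, so each recursion step
  -- closes by commutativity.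
  sumPowerset-∁ : ∀ n (f : Subset n → Carrier) →
    sumPowerset n (f ∘ ∁) ≈ sumPowerset n f
  sumPowerset-∁ zero    f = ≈-refl
  sumPowerset-∁ (suc n) f = ≈-trans
    (+-cong (sumPowerset-∁ n (f ∘ (inside ∷_))) (sumPowerset-∁ n (f ∘ (outside ∷_))))
    (+-comm _ _)

  sumPowerset-nonneg : ∀ n {f : Subset n → Carrier} → (∀ L → 0# ≤ f L) →
    0# ≤ sumPowerset n f
  sumPowerset-nonneg zero    0≤f = 0≤f []
  sumPowerset-nonneg (suc n) 0≤f =
    +-nonneg (sumPowerset-nonneg n (0≤f ∘ (outside ∷_))) (sumPowerset-nonneg n (0≤f ∘ (inside ∷_)))

  term≤sumPowerset : ∀ n {f : Subset n → Carrier} → (∀ L → 0# ≤ f L) →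
    ∀ S → f S ≤ sumPowerset n f
  term≤sumPowerset zero    0≤f [] = ≤-refl
  term≤sumPowerset (suc n) 0≤f (false ∷ S) = ≤-trans
    (term≤sumPowerset n (0≤f ∘ (outside ∷_)) S)
    (x≤x+nonneg (sumPowerset-nonneg n (0≤f ∘ (inside ∷_))))
  term≤sumPowerset (suc n) 0≤f (true ∷ S) = ≤-trans
    (term≤sumPowerset n (0≤f ∘ (inside ∷_)) S)
    (x≤nonneg+x (sumPowerset-nonneg n (0≤f ∘ (outside ∷_))))

  module _ {n : ℕ} where

    sumOver-cong : ∀ (𝒮 : SetSystem n) {f g} → (∀ L → L ∈ₛ 𝒮 → f L ≈ g L) →
      sumOver 𝒮 f ≈ sumOver 𝒮 g
    sumOver-cong 𝒮 {f} {g} f≈g = sumPowerset-cong n pointwise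
      where
      pointwise : ∀ L → (if 𝒮 L then f L else 0#) ≈ (if 𝒮 L then g L else 0#)
      pointwise L with 𝒮 L | f≈g L
      ... | true  | eq = eq _
      ... | false | _  = ≈-refl

    sumOver-+ : ∀ (𝒮 : SetSystem n) f g →
      ∑[ L ∈ 𝒮 ] (f L + g L) ≈ sumOver 𝒮 f + sumOver 𝒮 g
    sumOver-+ 𝒮 f g = ≈-trans (sumPowerset-cong n pointwise) (sumPowerset-+ n _ _)
      where
      pointwise : ∀ L → (if 𝒮 L then f L + g L else 0#)
                      ≈ (if 𝒮 L then f L else 0#) + (if 𝒮 L then g L else 0#)
      pointwise L with 𝒮 L
      ... | true  = ≈-refl
      ... | false = ≈-sym (+-identityˡ 0#)

    sumOver-*ˡ : ∀ (𝒮 : SetSystem n) a f → ∑[ L ∈ 𝒮 ] a * f L ≈ a * sumOver 𝒮 f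
    sumOver-*ˡ 𝒮 a f = ≈-trans (sumPowerset-cong n pointwise) (sumPowerset-*ˡ n a _)
      where
      pointwise : ∀ L → (if 𝒮 L then a * f L else 0#) ≈ a * (if 𝒮 L then f L else 0#)
      pointwise L with 𝒮 L
      ... | true  = ≈-refl
      ... | false = ≈-sym (zeroʳ a)

    sumOver-conjugate : ∀ {𝒮 𝒯 : SetSystem n} → Conjugate 𝒮 𝒯 → ∀ f →
      sumOver 𝒯 (f ∘ ∁) ≈ sumOver 𝒮 f
    sumOver-conjugate {𝒮} {𝒯} (conjugate 𝒯≡) f = ≈-trans
      (sumPowerset-cong n (λ L →
        reflexive (cong (λ b → if b then f (∁ L) else 0#) (𝒯≡ L))))
      (sumPowerset-∁ n (λ L → if 𝒮 L then f L else 0#))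

    sumOver-restrict : ∀ {𝒯 𝒮 : SetSystem n} {f} → (∀ L → L ∈ₛ 𝒯 → L ∈ₛ 𝒮) →
      (∀ L → L ∈ₛ 𝒮 → ¬ (L ∈ₛ 𝒯) → f L ≈ 0#) → sumOver 𝒯 f ≈ sumOver 𝒮 f
    sumOver-restrict {𝒯} {𝒮} {f} 𝒯⊆𝒮 f≈0 = sumPowerset-cong n pointwise
      where
      pointwise : ∀ L → (if 𝒯 L then f L else 0#) ≈ (if 𝒮 L then f L else 0#)
      pointwise L with 𝒯 L | 𝒮 L | 𝒯⊆𝒮 L | f≈0 L
      ... | true  | true  | _   | _  = ≈-refl
      ... | true  | false | T⊆S | _  = ⊥-elim (T⊆S _)
      ... | false | true  | _   | eq = ≈-sym (eq _ (λ ()))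
      ... | false | false | _   | _  = ≈-refl

    indicated-nonneg : ∀ (𝒮 : SetSystem n) (f : Subset n → Carrier) → (∀ L → L ∈ₛ 𝒮 → 0# ≤ f L) →
      ∀ L → 0# ≤ (if 𝒮 L then f L else 0#)
    indicated-nonneg 𝒮 f 0≤f L with 𝒮 L | 0≤f L
    ... | true  | 0≤ = 0≤ _
    ... | false | _  = ≤-refl

    sumOver-nonneg : ∀ (𝒮 : SetSystem n) {f} → (∀ L → L ∈ₛ 𝒮 → 0# ≤ f L) →
      0# ≤ sumOver 𝒮 f
    sumOver-nonneg 𝒮 {f} 0≤f = sumPowerset-nonneg n (indicated-nonneg 𝒮 f 0≤f)

    term≤sumOver : ∀ (𝒮 : SetSystem n) {f} → (∀ L → L ∈ₛ 𝒮 → 0# ≤ f L) →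
      ∀ S → S ∈ₛ 𝒮 → f S ≤ sumOver 𝒮 f
    term≤sumOver 𝒮 {f} 0≤f S S∈ = ≤-respˡ-≈ (indicated S S∈)
      (term≤sumPowerset n (indicated-nonneg 𝒮 f 0≤f) S)
      where
      indicated : ∀ S → S ∈ₛ 𝒮 → (if 𝒮 S then f S else 0#) ≈ f S
      indicated S S∈ with 𝒮 S
      ... | true = ≈-refl

-- Combinations of incidence vectors under complementation.

module Combinations (ℝ : CompleteOrderedField) (n : ℕ) where
  open CompleteOrderedField ℝ
    hiding (Carrier; _≈_; _≤_; _<_; _+_; _*_; _-_; -_; 0#; 1#)
  open OrderedField ℝ
  open PowersetSums ℝ
  open Games ℝ n
  open import Relation.Binary.Reasoning.Setoid setoid

  private variable
    𝒮 𝒯 : SetSystem n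

  χ-inside : ∀ {S i} → lookup S i ≡ inside → χ S i ≡ 1#
  χ-inside S∋i = cong (λ b → if b then 1# else 0#) S∋i

  ⋆ᵛ-involutive : ∀ (θ : ℝᴾ) L → (θ ⋆ᵛ ⋆ᵛ) L ≡ θ L
  ⋆ᵛ-involutive θ L = cong θ (∁-involutive L)

  combination-linear : ∀ (𝒮 : SetSystem n) a c b d i →
    combination 𝒮 (λ L → a * c L + b * d L) i
      ≈ a * combination 𝒮 c i + b * combination 𝒮 d i
  combination-linear 𝒮 a c b d i = begin
    ∑[ L ∈ 𝒮 ] (a * c L + b * d L) * χ L i
      ≈⟨ sumOver-cong 𝒮 (λ L _ → ≈-trans (distribʳ (χ L i) _ _)
           (+-cong (*-assoc a (c L) (χ L i)) (*-assoc b (d L) (χ L i)))) ⟩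
    ∑[ L ∈ 𝒮 ] (a * (c L * χ L i) + b * (d L * χ L i))
      ≈⟨ sumOver-+ 𝒮 _ _ ⟩
    (∑[ L ∈ 𝒮 ] a * (c L * χ L i)) + (∑[ L ∈ 𝒮 ] b * (d L * χ L i))
      ≈⟨ +-cong (sumOver-*ˡ 𝒮 a _) (sumOver-*ˡ 𝒮 b _) ⟩
    a * combination 𝒮 c i + b * combination 𝒮 d i ∎

  sumOver-linear : ∀ (𝒮 : SetSystem n) a c b d →
    ∑[ L ∈ 𝒮 ] (a * c L + b * d L) ≈ a * sumOver 𝒮 c + b * sumOver 𝒮 d
  sumOver-linear 𝒮 a c b d =
    ≈-trans (sumOver-+ 𝒮 _ _) (+-cong (sumOver-*ˡ 𝒮 a c) (sumOver-*ˡ 𝒮 b d))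

  combination-*ˡ : ∀ (𝒮 : SetSystem n) a c i →
    combination 𝒮 (λ L → a * c L) i ≈ a * combination 𝒮 c i
  combination-*ˡ 𝒮 a c i =
    ≈-trans (sumOver-cong 𝒮 (λ L _ → *-assoc a (c L) (χ L i))) (sumOver-*ˡ 𝒮 a _)

  -- `χ (∁ L)` and `χ L` add up to the all-one vector, so the two combinations add up to the
  -- coefficient sum in each coordinate.
  combination-conjugate : Conjugate 𝒮 𝒯 → ∀ c i →
    combination 𝒯 (c ⋆ᵛ) i ≈ sumOver 𝒮 c - combination 𝒮 c i
  combination-conjugate {𝒮} {𝒯} conj c i = x+y≈z⇒x≈z-y (begin
    combination 𝒯 (c ⋆ᵛ) i + combination 𝒮 c i
      -- The double complement exhibits the summand as a function of `∁ L`, ready for reindexing.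
      ≈⟨ +-congʳ (sumOver-cong 𝒯 (λ L _ → *-congˡ
           (reflexive (cong (λ K → χ K i) (≡.sym (∁-involutive L)))))) ⟩
    (∑[ L ∈ 𝒯 ] c (∁ L) * χ (∁ (∁ L)) i) + combination 𝒮 c i
      ≈⟨ +-congʳ (sumOver-conjugate conj (λ L → c L * χ (∁ L) i)) ⟩
    (∑[ L ∈ 𝒮 ] c L * χ (∁ L) i) + combination 𝒮 c i
      ≈⟨ sumOver-+ 𝒮 _ _ ⟨
    ∑[ L ∈ 𝒮 ] (c L * χ (∁ L) i + c L * χ L i)
      ≈⟨ sumOver-cong 𝒮 (λ L _ → ≈-trans (≈-sym (distribˡ (c L) _ _))
           (≈-trans (*-congˡ (χ∁+χ L)) (*-identityʳ (c L)))) ⟩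
    sumOver 𝒮 c ∎)
    where
    χ∁+χ : ∀ L → χ (∁ L) i + χ L i ≈ 1#
    χ∁+χ L rewrite lookup-map i not L with lookup L i
    ... | true  = +-identityˡ 1#
    ... | false = +-identityʳ 1#

  yieldsConstant-conjugate : Conjugate 𝒮 𝒯 → ∀ {c r} →
    YieldsConstant 𝒮 c r → YieldsConstant 𝒯 (c ⋆ᵛ) (sumOver 𝒮 c - r)
  yieldsConstant-conjugate conj {c} yields i =
    ≈-trans (combination-conjugate conj c i) (+-congˡ (-‿cong (yields i)))

  conic-conjugate : Conjugate 𝒮 𝒯 → ∀ {c} → Conic 𝒮 c → Conic 𝒯 (c ⋆ᵛ)
  conic-conjugate conj conic S S∈ = conic (∁ S) (∁-∈ conj S S∈)

  semiConic-conjugate : Conjugate 𝒮 𝒯 → ∀ {c} → SemiConic 𝒮 c → SemiConic 𝒯 (c ⋆ᵛ)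
  semiConic-conjugate conj semiConic S L S∈ L∈ cS<0 cL<0 = ∁-injective
    (semiConic (∁ S) (∁ L) (∁-∈ conj S S∈) (∁-∈ conj L L∈) cS<0 cL<0)

  allNonZero-conjugate : Conjugate 𝒮 𝒯 → ∀ {c} → AllNonZero 𝒮 c → AllNonZero 𝒯 (c ⋆ᵛ)
  allNonZero-conjugate conj nonZero S S∈ = nonZero (∁ S) (∁-∈ conj S S∈)

  semiBalanced-conjugate : Conjugate 𝒮 𝒯 → SemiBalanced 𝒮 → SemiBalanced 𝒯
  semiBalanced-conjugate {𝒮} conj (nonTrivial , c , r , semiConic , nonZero , yields) =
    nonTrivial-conjugate conj nonTrivial , c ⋆ᵛ , sumOver 𝒮 c - r ,
    semiConic-conjugate conj semiConic ,
    allNonZero-conjugate conj nonZero ,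
    yieldsConstant-conjugate conj yields

  -- Semi-conicity with the exceptional set named. Nonnegative combinations of vectors with a common
  -- exception keep it, whereas a sum of semi-conic vectors need not be semi-conic. `T` may lie
  -- outside the system.
  NonnegExcept : Subset n → SetSystem n → ℝᴾ → Set
  NonnegExcept T 𝒮 c = ∀ S → S ∈ₛ 𝒮 → S ≢ T → 0# ≤ c S

  nonnegExcept⇒semiConic : ∀ {T c} → NonnegExcept T 𝒮 c → SemiConic 𝒮 c
  nonnegExcept⇒semiConic {𝒮} {T} {c} nonneg S L S∈ L∈ cS<0 cL<0 =
    ≡.trans (negative S S∈ cS<0) (≡.sym (negative L L∈ cL<0))
    where
    negative : ∀ S → S ∈ₛ 𝒮 → c S < 0# → S ≡ T
    negative S S∈ cS<0 = decidable-stable (S ≟ˢ T) (<⇒≱ cS<0 ∘ nonneg S S∈)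

  semiConic⇒conic⊎nonnegExcept : ∀ {c} → SemiConic 𝒮 c →
    Conic 𝒮 c ⊎ (∃[ T ] (T ∈ₛ 𝒮 × c T < 0# × NonnegExcept T 𝒮 c))
  semiConic⇒conic⊎nonnegExcept {𝒮} {c} semiConic
    with anySubset? (λ T → T? (𝒮 T) ×-dec c T <? 0#)
  ... | yes (T , T∈ , cT<0) =
    inj₂ (T , T∈ , cT<0 , λ S S∈ S≢T → ≮0⇒0≤ (λ cS<0 → S≢T (semiConic S T S∈ T∈ cS<0 cT<0)))
  ... | no ∄neg = inj₁ (λ S S∈ → ≮0⇒0≤ (λ cS<0 → ∄neg (S , S∈ , cS<0)))

  conic⇒nonnegExcept : ∀ {T c} → Conic 𝒮 c → NonnegExcept T 𝒮 c
  conic⇒nonnegExcept conic S S∈ _ = conic S S∈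

  -- In coordinate `i` only the sets containing `i` contribute, so signs matter for them alone; a
  -- single negative coefficient is avoided by an `i` outside its set.
  module _ {c r} (yields : YieldsConstant 𝒮 c r) {i}
           (nonneg : ∀ L → L ∈ₛ 𝒮 → lookup L i ≡ inside → 0# ≤ c L) where

    private
      term-nonneg : ∀ L → L ∈ₛ 𝒮 → 0# ≤ c L * χ L i
      term-nonneg L L∈ with lookup L i | nonneg L L∈
      ... | true  | 0≤cL = *-nonneg (0≤cL ≡.refl) 0≤1
      ... | false | _    = ≤-reflexive (≈-sym (zeroʳ (c L)))

    0≤constant : 0# ≤ r
    0≤constant = ≤-respʳ-≈ (yields i) (sumOver-nonneg 𝒮 term-nonneg)

    coefficient≤constant : ∀ S → S ∈ₛ 𝒮 → lookup S i ≡ inside → c S ≤ r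
    coefficient≤constant S S∈ S∋i = ≈-respects-≤
      (≈-trans (*-congˡ (reflexive (χ-inside {S} S∋i))) (*-identityʳ (c S)))
      (yields i) (term≤sumOver 𝒮 term-nonneg S S∈)

  conic⇒0<constant : ∀ {c r} → NonTrivial 𝒮 → Conic 𝒮 c → AllNonZero 𝒮 c →
    YieldsConstant 𝒮 c r → 0# < r
  conic⇒0<constant {𝒮} ((S , S∈) , ⊥∉ , _) conic nonZero yields
    with ≢⊥⇒inside S (λ S≡⊥ → ⊥∉ (subst (_∈ₛ 𝒮) S≡⊥ S∈))
  ... | i , S∋i = <-≤-trans (0≤∧≉0⇒0< (conic S S∈) (nonZero S S∈))
    (coefficient≤constant yields (λ L L∈ _ → conic L L∈) S S∈ S∋i)

  balanced-conjugate : Conjugate 𝒮 𝒯 → Balanced 𝒮 → Balanced 𝒯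
  balanced-conjugate {𝒮} {𝒯} conj (nonTrivial , c , conic , nonZero , yields) =
    -- `c ⋆ᵛ` yields the constant `s`; division by `s` turns this into `χ ⊤`.
    nonTrivial′ , (λ S → recip s * (c ⋆ᵛ) S) ,
    (λ S S∈ → *-nonneg (proj₁ 0<recip) (conic′ S S∈)) ,
    (λ S S∈ → *-≉0 (proj₂ 0<recip ∘ ≈-sym) (nonZero′ S S∈)) ,
    λ i → begin
      combination 𝒯 (λ S → recip s * (c ⋆ᵛ) S) i   ≈⟨ combination-*ˡ 𝒯 (recip s) (c ⋆ᵛ) i ⟩
      recip s * combination 𝒯 (c ⋆ᵛ) i             ≈⟨ *-congˡ (yields′ i) ⟩
      recip s * s                                  ≈⟨ recip-* (proj₂ 0<s ∘ ≈-sym) ⟩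
      1#                                           ≈⟨ χ⊤ i ⟨
      χ ⊤ i                                        ∎
    where
    χ⊤ : ∀ i → χ ⊤ i ≈ 1#
    χ⊤ i = reflexive (χ-inside {⊤} (lookup-replicate i true))
    s = sumOver 𝒮 c - 1#
    nonTrivial′ = nonTrivial-conjugate conj nonTrivial
    conic′ = conic-conjugate conj conic
    nonZero′ = allNonZero-conjugate conj nonZero
    yields′ : YieldsConstant 𝒯 (c ⋆ᵛ) s
    yields′ = yieldsConstant-conjugate conj (λ i → ≈-trans (yields i) (χ⊤ i))
    0<s : 0# < s
    0<s = conic⇒0<constant nonTrivial′ conic′ nonZero′ yields′
    0<recip = recip-pos 0<s

  -- A smaller system `𝒰` below `𝒯` with property `P` would give `𝒰 ⋆` below `𝒮` with the same
  -- property.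
  minimal-conjugate : (P : Pred (SetSystem n) 0ℓ) →
    (∀ {𝒮 𝒯} → Conjugate 𝒮 𝒯 → P 𝒮 → P 𝒯) → Conjugate 𝒮 𝒯 →
    P 𝒮 × (∀ 𝒰 → 𝒰 ⊊ₛ 𝒮 → ¬ P 𝒰) → P 𝒯 × (∀ 𝒰 → 𝒰 ⊊ₛ 𝒯 → ¬ P 𝒰)
  minimal-conjugate P P-conjugate conj (P𝒮 , minimal) =
    P-conjugate conj P𝒮 , λ 𝒰 𝒰⊊𝒯 P𝒰 →
      minimal (𝒰 ⋆) (⊊ₛ-conjugate conj 𝒰⊊𝒯) (P-conjugate (conjugate-⋆ 𝒰) P𝒰)

  -- Makes normalisation to an affine combination possible. With a negative coefficient at `T`, the
  -- constant `r` and the conjugate constant `s` are both nonnegative and add up to the sum; any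
  -- further member bounds one of them below by a positive coefficient.
  0<sum : ∀ {c r} → NonTrivial 𝒮 → SemiConic 𝒮 c → AllNonZero 𝒮 c →
    YieldsConstant 𝒮 c r → 0# < sumOver 𝒮 c
  0<sum {𝒮} {c} {r} nonTrivial@((S₀ , S₀∈) , ⊥∉ , ⊤∉) semiConic nonZero yields
    with semiConic⇒conic⊎nonnegExcept semiConic
  ... | inj₁ conic = <-≤-trans (0≤∧≉0⇒0< (conic S₀ S₀∈) (nonZero S₀ S₀∈))
    (term≤sumOver 𝒮 conic S₀ S₀∈)
  ... | inj₂ (T , T∈ , cT<0 , nonneg) = conclusion
    where
    conj = conjugate-⋆ 𝒮
    s = sumOver 𝒮 c - r
    yields′ : YieldsConstant (𝒮 ⋆) (c ⋆ᵛ) s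
    yields′ = yieldsConstant-conjugate conj yields

    off-T : ∀ {k} → lookup T k ≡ outside →
      ∀ L → L ∈ₛ 𝒮 → lookup L k ≡ inside → 0# ≤ c L
    off-T T∌k L L∈ L∋k = nonneg L L∈ λ { ≡.refl → contradiction (≡.trans (≡.sym L∋k) T∌k) λ () }

    on-T : ∀ {k} → lookup T k ≡ inside →
      ∀ L → L ∈ₛ 𝒮 ⋆ → lookup L k ≡ inside → 0# ≤ (c ⋆ᵛ) L
    on-T {k} T∋k L L∈ L∋k = nonneg (∁ L) L∈ λ ∁L≡T → contradiction
      (≡.trans (≡.sym T∋k) (≡.trans (cong (λ K → lookup K k) (≡.sym ∁L≡T))
        (≡.trans (lookup-map k not L) (cong not L∋k)))) λ ()

    -- At an element outside `T` the negative coefficient does not contribute.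
    0≤r : 0# ≤ r
    0≤r with ≢⊤⇒outside T (λ T≡⊤ → ⊤∉ (subst (_∈ₛ 𝒮) T≡⊤ T∈))
    ... | k , T∌k = 0≤constant yields (off-T T∌k)

    -- In the conjugate system the set to avoid is `∁ T`, so an element of `T` is taken.
    0≤s : 0# ≤ s
    0≤s with ≢⊥⇒inside T (λ T≡⊥ → ⊥∉ (subst (_∈ₛ 𝒮) T≡⊥ T∈))
    ... | k , T∋k = 0≤constant yields′ (on-T T∋k)

    s+r≈sum : s + r ≈ sumOver 𝒮 c
    s+r≈sum = x-y+y≈x (sumOver 𝒮 c) r

    r≤sum : r ≤ sumOver 𝒮 c
    r≤sum = ≤-respʳ-≈ s+r≈sum (x≤nonneg+x 0≤s)

    s≤sum : s ≤ sumOver 𝒮 c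
    s≤sum = ≤-respʳ-≈ s+r≈sum (x≤x+nonneg 0≤r)

    conclusion : 0# < sumOver 𝒮 c
    conclusion with anySubset? (λ S → T? (𝒮 S) ×-dec ¬? (S ≟ˢ T))
    -- Where `S` and `T` differ, either `S` contains `k` and its coefficient bounds `r`, or `∁ S`
    -- contains `k` and it bounds `s`.
    ... | yes (S , S∈ , S≢T) with ≢⇒lookup≢ S T S≢T
    ...   | k , Sk≢Tk with lookup S k in Sk | lookup T k in Tk
    ...     | true  | true  = contradiction ≡.refl Sk≢Tk
    ...     | false | false = contradiction ≡.refl Sk≢Tk
    ...     | true  | false = <-≤-trans (0≤∧≉0⇒0< (nonneg S S∈ S≢T) (nonZero S S∈))
      (≤-trans (coefficient≤constant yields (off-T Tk) S S∈ Sk) r≤sum)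
    ...     | false | true  = <-≤-trans (0≤∧≉0⇒0< (nonneg S S∈ S≢T) (nonZero S S∈))
      (≤-trans (≤-respˡ-≈ (reflexive (⋆ᵛ-involutive c S))
        (coefficient≤constant yields′ (on-T Tk) (∁ S) (∁-∈ (conjugate-sym conj) S S∈)
          (≡.trans (lookup-map k not S) (cong not Sk)))) s≤sum)
    -- `T` is the only member, so `- c` is conic and its constant `- r` would be positive, against
    -- `0≤r`.
    conclusion | no ∄S = contradiction
      (≤-respˡ-≈ (≈-sym (-1*x≈-x r)) (0≤⇒-≤0 0≤r))
      (<⇒≱ (conic⇒0<constant nonTrivial negated-conic
        (λ S S∈ → *-≉0 -1≉0 (nonZero S S∈))
        (λ i → ≈-trans (combination-*ˡ 𝒮 (- 1#) c i) (*-congˡ (yields i)))))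
      where
      -1≉0 : ¬ (- 1# ≈ 0#)
      -1≉0 eq = 0≉1 (begin
        0#        ≈⟨ -0#≈0# ⟨
        - 0#      ≈⟨ -‿cong eq ⟨
        - - 1#    ≈⟨ -‿involutive 1# ⟩
        1#        ∎)
      negated-conic : Conic 𝒮 (λ S → - 1# * c S)
      negated-conic S S∈ with S ≟ˢ T
      ... | yes ≡.refl = ≤-respʳ-≈ (≈-sym (-1*x≈-x (c S))) (≤0⇒0≤- (proj₁ cT<0))
      ... | no S≢T     = contradiction (S , S∈ , S≢T) ∄S

  -- Uniqueness of affine semi-conic combinations over min-semi-balanced systems.

  vanishing : ∀ {c r} → MinSemiBalanced 𝒮 → SemiConic 𝒮 c → YieldsConstant 𝒮 c r →
    ∀ {S} → S ∈ₛ 𝒮 → c S ≈ 0# → ∀ L → L ∈ₛ 𝒮 → c L ≈ 0#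
  vanishing {𝒮} {c} {r} ((( _ , ⊥∉ , ⊤∉) , _) , minimal) semiConic yields {S} S∈ cS≈0 L L∈ =
    -- Minimality only refutes `c L` being nonzero, and decidable equality converts this. `L`
    -- witnesses that the support is nonempty, `S` that the inclusion is strict.
    decidable-stable (c L ≟ 0#) λ cL≉0 → minimal support
      (support⊆𝒮 , S , S∈ , λ S∈supp → support-≉0 S S∈supp cS≈0)
      (((L , ≉0-support L L∈ cL≉0) , ⊥∉ ∘ support⊆𝒮 ⊥ , ⊤∉ ∘ support⊆𝒮 ⊤) ,
       c , r , (λ A B A∈ B∈ → semiConic A B (support⊆𝒮 A A∈) (support⊆𝒮 B B∈)) ,
       support-≉0 ,
       λ i → ≈-trans (sumOver-restrict support⊆𝒮 (off-support i)) (yields i))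
    where
    nonZero? : Decidable (λ L → ¬ (c L ≈ 0#))
    nonZero? L = ¬? (c L ≟ 0#)
    support : SetSystem n
    support L = 𝒮 L ∧ isYes (nonZero? L)
    support⊆𝒮 : ∀ L → L ∈ₛ support → L ∈ₛ 𝒮
    support⊆𝒮 L = proj₁ ∘ Equivalence.to T-∧
    support-≉0 : ∀ L → L ∈ₛ support → ¬ (c L ≈ 0#)
    support-≉0 L L∈ = toWitness {a? = nonZero? L} (proj₂ (Equivalence.to (T-∧ {𝒮 L}) L∈))
    ≉0-support : ∀ L → L ∈ₛ 𝒮 → ¬ (c L ≈ 0#) → L ∈ₛ support
    ≉0-support L L∈ cL≉0 = Equivalence.from T-∧ (L∈ , fromWitness {a? = nonZero? L} cL≉0)
    off-support : ∀ i L → L ∈ₛ 𝒮 → ¬ (L ∈ₛ support) → c L * χ L i ≈ 0#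
    off-support i L L∈ L∉ = ≈-trans
      (*-congʳ (decidable-stable (c L ≟ 0#) (L∉ ∘ ≉0-support L L∈))) (zeroˡ (χ L i))

  yieldsConstant-linear : ∀ {c d r s} a b → YieldsConstant 𝒮 c r → YieldsConstant 𝒮 d s →
    YieldsConstant 𝒮 (λ L → a * c L + b * d L) (a * r + b * s)
  yieldsConstant-linear {𝒮} {c} {d} a b c-yields d-yields i = ≈-trans
    (combination-linear 𝒮 a c b d i) (+-cong (*-congˡ (c-yields i)) (*-congˡ (d-yields i)))

  affine-linear : ∀ {c d} a b → Affine 𝒮 c → Affine 𝒮 d →
    ∑[ L ∈ 𝒮 ] (a * c L + b * d L) ≈ a + b
  affine-linear {𝒮} {c} {d} a b c-affine d-affine = ≈-trans (sumOver-linear 𝒮 a c b d)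
    (+-cong (≈-trans (*-congˡ c-affine) (*-identityʳ a))
            (≈-trans (*-congˡ d-affine) (*-identityʳ b)))

  sumOver-zero : ∀ {c} → (∀ L → L ∈ₛ 𝒮 → c L ≈ 0#) → sumOver 𝒮 c ≈ 0#
  sumOver-zero {𝒮} {c} c≈0 = begin
    sumOver 𝒮 c               ≈⟨ sumOver-cong 𝒮 (λ L L∈ → ≈-trans (c≈0 L L∈) (≈-sym (zeroˡ 0#))) ⟩
    ∑[ L ∈ 𝒮 ] 0# * 0#        ≈⟨ sumOver-*ˡ 𝒮 0# (λ _ → 0#) ⟩
    0# * sumOver 𝒮 (λ _ → 0#) ≈⟨ zeroˡ _ ⟩
    0#                        ∎

  -- By `vanishing`, one zero coefficient would make all of them zero, and the sum could not be one.
  affine⇒allNonZero : ∀ {c r} → MinSemiBalanced 𝒮 → Affine 𝒮 c → SemiConic 𝒮 c →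
    YieldsConstant 𝒮 c r → AllNonZero 𝒮 c
  affine⇒allNonZero min affine semiConic yields S S∈ cS≈0 = 0≉1
    (≈-trans (≈-sym (sumOver-zero (vanishing min semiConic yields S∈ cS≈0))) affine)

  module _ {c d r s} (min : MinSemiBalanced 𝒮)
           (c-affine : Affine 𝒮 c) (c-semiConic : SemiConic 𝒮 c) (c-yields : YieldsConstant 𝒮 c r)
           (d-affine : Affine 𝒮 d) (d-semiConic : SemiConic 𝒮 d) (d-yields : YieldsConstant 𝒮 d s) where

    private
      c≉0 = affine⇒allNonZero min c-affine c-semiConic c-yields
      d≉0 = affine⇒allNonZero min d-affine d-semiConic d-yields

    common-exception⇒≈ : ∀ {T} → NonnegExcept T 𝒮 c → NonnegExcept T 𝒮 d →
      ∀ S → S ∈ₛ 𝒮 → d S ≈ c S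
    common-exception⇒≈ {T} c-nonneg d-nonneg = d≈c
      where
      q : ℝᴾ
      q L = d L * recip (c L)

      d≈q*c : ∀ L → L ∈ₛ 𝒮 → d L ≈ q L * c L
      d≈q*c L L∈ = begin
        d L                        ≈⟨ *-identityʳ (d L) ⟨
        d L * 1#                   ≈⟨ *-congˡ (recip-* (c≉0 L L∈)) ⟨
        d L * (recip (c L) * c L)  ≈⟨ *-assoc (d L) (recip (c L)) (c L) ⟨
        q L * c L                  ∎

      leastRatio : ∃[ A ] (A ∈ₛ 𝒮 × (∀ L → L ∈ₛ 𝒮 → L ≢ T → q A ≤ q L))
      -- The minimum leaves out `T`, where the sign of `e` below is free; if `T` is the only member,
      -- any member serves as `A`.
      leastRatio with anySubset? (λ L → T? (𝒮 L) ×-dec ¬? (L ≟ˢ T))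
      ... | no ∄L with proj₁ (proj₁ (proj₁ min))
      ...   | A , A∈ = A , A∈ , λ L L∈ L≢T → contradiction (L , L∈ , L≢T) ∄L
      leastRatio | yes ∃L with argmin (λ L → T? (𝒮 L) ×-dec ¬? (L ≟ˢ T)) q ∃L
      ...   | A , (A∈ , _) , least = A , A∈ , λ L L∈ L≢T → least L (L∈ , L≢T)

      A = proj₁ leastRatio
      ρ = q A

      e : ℝᴾ
      -- `d - ρ c` in the shape of the linearity lemmas. By `e≈` it is `c` scaled by `q L - ρ`, a
      -- factor that is nonnegative off `T` and zero at `A`.
      e L = 1# * d L + - ρ * c L

      e≈ : ∀ L → L ∈ₛ 𝒮 → e L ≈ (q L - ρ) * c L
      e≈ L L∈ = ≈-trans (+-congʳ (≈-trans (*-identityˡ (d L)) (d≈q*c L L∈)))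
        (≈-sym (distribʳ (c L) (q L) (- ρ)))

      eA≈0 : e A ≈ 0#
      eA≈0 = ≈-trans (e≈ A (proj₁ (proj₂ leastRatio)))
        (≈-trans (*-congʳ (-‿inverseʳ ρ)) (zeroˡ (c A)))

      e-nonneg : NonnegExcept T 𝒮 e
      e-nonneg L L∈ L≢T = ≤-respʳ-≈ (≈-sym (e≈ L L∈))
        (*-nonneg (x≤y⇒0≤y-x (proj₂ (proj₂ leastRatio) L L∈ L≢T)) (c-nonneg L L∈ L≢T))

      e≈0 : ∀ L → L ∈ₛ 𝒮 → e L ≈ 0#
      e≈0 = vanishing min (nonnegExcept⇒semiConic e-nonneg)
        (yieldsConstant-linear 1# (- ρ) d-yields c-yields) (proj₁ (proj₂ leastRatio)) eA≈0

      -- The coefficients of `e` sum to `1# - ρ` by affinity, and all of them vanish.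
      1≈ρ : 1# ≈ ρ
      1≈ρ = x-y≈0⇒x≈y (≈-trans (≈-sym (affine-linear 1# (- ρ) d-affine c-affine))
        (sumOver-zero e≈0))

      d≈c : ∀ S → S ∈ₛ 𝒮 → d S ≈ c S
      d≈c S S∈ = x-y≈0⇒x≈y (begin
        d S - c S             ≈⟨ +-congˡ (-‿cong (*-identityˡ (c S))) ⟨
        d S - 1# * c S        ≈⟨ +-congˡ (-‿cong (*-congʳ 1≈ρ)) ⟩
        d S - ρ * c S         ≈⟨ +-cong (*-identityˡ (d S)) (≈-sym (-‿distribˡ-* ρ (c S))) ⟨
        e S                   ≈⟨ e≈0 S S∈ ⟩
        0#                    ∎)

    -- d T * c - c T * d vanishes at T, but its coefficients have a positive sum.
    ¬distinct-exceptions : ∀ {T U} → T ∈ₛ 𝒮 → T ≢ U → c T < 0# →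
      NonnegExcept T 𝒮 c → NonnegExcept U 𝒮 d → Empty
    ¬distinct-exceptions {T} {U} T∈ T≢U (cT≤0 , _) c-nonneg d-nonneg =
      d≉0 T T∈ (antisym dT≤0 0≤dT)
      where
      0≤dT = d-nonneg T T∈ T≢U
      0≤-cT = ≤0⇒0≤- cT≤0

      e : ℝᴾ
      e L = d T * c L + - c T * d L

      eT≈0 : e T ≈ 0#
      eT≈0 = begin
        d T * c T + - c T * d T    ≈⟨ +-cong (*-comm (d T) (c T)) (≈-sym (-‿distribˡ-* (c T) (d T))) ⟩
        c T * d T - c T * d T      ≈⟨ -‿inverseʳ (c T * d T) ⟩
        0#                         ∎

      -- Off `U` only `d T * c` can be negative, and only at `T`, where `e` is zero.
      e-nonneg : NonnegExcept U 𝒮 e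
      e-nonneg L L∈ L≢U with L ≟ˢ T
      ... | yes ≡.refl = ≤-reflexive (≈-sym eT≈0)
      ... | no L≢T = +-nonneg (*-nonneg 0≤dT (c-nonneg L L∈ L≢T))
        (*-nonneg 0≤-cT (d-nonneg L L∈ L≢U))

      sum≈0 : d T + - c T ≈ 0#
      sum≈0 = ≈-trans (≈-sym (affine-linear (d T) (- c T) c-affine d-affine))
        (sumOver-zero (vanishing min (nonnegExcept⇒semiConic e-nonneg)
          (yieldsConstant-linear (d T) (- c T) c-yields d-yields) T∈ eT≈0))

      -- `d T` and `- c T` are nonnegative with sum zero, which forces `d T` to vanish, against
      -- `d≉0`.
      dT≤0 : d T ≤ 0#
      dT≤0 = ≤-respʳ-≈ sum≈0 (x≤x+nonneg 0≤-cT)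

    affine-unique : ∀ S → S ∈ₛ 𝒮 → d S ≈ c S
    affine-unique
      with semiConic⇒conic⊎nonnegExcept c-semiConic | semiConic⇒conic⊎nonnegExcept d-semiConic
    ... | inj₁ c-conic | inj₁ d-conic =
      -- Neither combination has an exception; `⊥` is an arbitrary choice.
      common-exception⇒≈ {⊥} (conic⇒nonnegExcept c-conic) (conic⇒nonnegExcept d-conic)
    ... | inj₁ c-conic | inj₂ (U , _ , _ , d-nonneg) =
      common-exception⇒≈ (conic⇒nonnegExcept c-conic) d-nonneg
    ... | inj₂ (T , _ , _ , c-nonneg) | inj₁ d-conic =
      common-exception⇒≈ c-nonneg (conic⇒nonnegExcept d-conic)
    ... | inj₂ (T , T∈ , cT<0 , c-nonneg) | inj₂ (U , _ , _ , d-nonneg) with T ≟ˢ U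
    ...   | yes ≡.refl = common-exception⇒≈ c-nonneg d-nonneg
    ...   | no T≢U     = ⊥-elim (¬distinct-exceptions T∈ T≢U cT<0 c-nonneg d-nonneg)

  -- The vectors assigned to affine combinations.

  Θ-conjugate : Conjugate 𝒮 𝒯 → ∀ {θ} → θ ∈ Θ 𝒮 → θ ⋆ᵛ ∈ Θ 𝒯
  Θ-conjugate {𝒮} {𝒯} conj {θ} (c , r , affine , semiConic , yields , assigned) =
    -- With coefficient sum one the new constant is `1# - r`, so the values prescribed at `⊤` and
    -- `⊥` change places, exactly as complementation moves them.
    c ⋆ᵛ , 1# - r , ≈-trans (sumOver-conjugate conj c) affine ,
    semiConic-conjugate conj semiConic ,
    (λ i → ≈-trans (yieldsConstant-conjugate conj yields i) (+-congʳ affine)) ,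
    record
      { on-𝒮      = λ S S∈ → on-𝒮 (∁ S) (∁-∈ conj S S∈)
      ; on-N      = ≈-trans (reflexive (cong θ (∁⊤≡⊥ n))) on-∅
      ; on-∅      = ≈-trans (reflexive (cong θ (∁⊥≡⊤ n)))
                      (≈-trans on-N (≈-sym (y-[y-x]≈x 1# r)))
      ; elsewhere = λ L L∉ L≢⊤ L≢⊥ → elsewhere (∁ L)
          (L∉ ∘ subst (_∈ₛ 𝒯) (∁-involutive L) ∘ ∁-∈ (conjugate-sym conj) (∁ L))
          (λ ∁L≡⊤ → L≢⊥ (∁-injective (≡.trans ∁L≡⊤ (≡.sym (∁⊥≡⊤ n)))))
          (λ ∁L≡⊥ → L≢⊤ (∁-injective (≡.trans ∁L≡⊥ (≡.sym (∁⊤≡⊥ n)))))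
      }
    where open AssignedTo assigned

  Θ-resp-≋ : ∀ {η θ} → η ≋ θ → θ ∈ Θ 𝒮 → η ∈ Θ 𝒮
  Θ-resp-≋ η≋θ (c , r , affine , semiConic , yields , assigned) =
    c , r , affine , semiConic , yields , record
      { on-𝒮      = λ S S∈ → ≈-trans (η≋θ S) (on-𝒮 S S∈)
      ; on-N      = ≈-trans (η≋θ ⊤) on-N
      ; on-∅      = ≈-trans (η≋θ ⊥) on-∅
      ; elsewhere = λ L L∉ L≢⊤ L≢⊥ → ≈-trans (η≋θ L) (elsewhere L L∉ L≢⊤ L≢⊥)
      }
    where open AssignedTo assigned

  -- The given coefficients are divided by their sum, positive by `0<sum`; positive scaling
  -- preserves signs and hence semi-conicity.
  minSemiBalanced⇒Θ-satisfiable : MinSemiBalanced 𝒮 → Satisfiable (Θ 𝒮)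
  minSemiBalanced⇒Θ-satisfiable {𝒮} ((nonTrivial , c , r , semiConic , nonZero , yields) , _) =
    θ , d , a * r , affine , d-semiConic , d-yields , record
      { on-𝒮      = on-𝒮
      ; on-N      = on-N
      ; on-∅      = on-∅
      ; elsewhere = elsewhere
      }
    where
    0<Σ = 0<sum nonTrivial semiConic nonZero yields
    a = recip (sumOver 𝒮 c)
    0<a = recip-pos 0<Σ

    d : ℝᴾ
    d L = a * c L

    affine : Affine 𝒮 d
    affine = ≈-trans (sumOver-*ˡ 𝒮 a c) (recip-* (proj₂ 0<Σ ∘ ≈-sym))

    d-negative⇒c-negative : ∀ S → d S < 0# → c S < 0#
    d-negative⇒c-negative S dS<0 = decidable-stable (c S <? 0#) λ cS≮0 →
      <⇒≱ dS<0 (*-nonneg (proj₁ 0<a) (≮0⇒0≤ cS≮0))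

    d-semiConic : SemiConic 𝒮 d
    d-semiConic S L S∈ L∈ dS<0 dL<0 = semiConic S L S∈ L∈
      (d-negative⇒c-negative S dS<0) (d-negative⇒c-negative L dL<0)

    d-yields : YieldsConstant 𝒮 d (a * r)
    d-yields i = ≈-trans (combination-*ˡ 𝒮 a c i) (*-congˡ (yields i))

    ⊥∉ = proj₁ (proj₂ nonTrivial)
    ⊤∉ = proj₂ (proj₂ nonTrivial)

    -- Ensures that the values prescribed at `⊤` and `⊥` do not clash; a nonempty member provides an
    -- element separating the two.
    ⊥≢⊤ : ⊥ {n} ≢ ⊤
    ⊥≢⊤ ⊥≡⊤ with proj₁ nonTrivial
    ... | S , S∈ with ≢⊥⇒inside S (λ S≡⊥ → ⊥∉ (subst (_∈ₛ 𝒮) S≡⊥ S∈))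
    ...   | i , _ = contradiction (≡.trans (≡.sym (lookup-replicate i false))
      (≡.trans (cong (λ L → lookup L i) ⊥≡⊤) (lookup-replicate i true))) λ ()

    θ : ℝᴾ
    θ L with T? (𝒮 L) | L ≟ˢ ⊤ | L ≟ˢ ⊥
    ... | yes _ | _     | _     = - d L
    ... | no _  | yes _ | _     = a * r
    ... | no _  | no _  | yes _ = 1# - a * r
    ... | no _  | no _  | no _  = 0#

    on-𝒮 : ∀ S → S ∈ₛ 𝒮 → θ S ≈ - d S
    on-𝒮 S S∈ with T? (𝒮 S)
    ... | yes _ = ≈-refl
    ... | no S∉ = contradiction S∈ S∉

    on-N : θ ⊤ ≈ a * r
    on-N with T? (𝒮 ⊤) | ⊤ {n} ≟ˢ ⊤
    ... | yes ⊤∈ | _      = contradiction ⊤∈ ⊤∉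
    ... | no _   | yes _  = ≈-refl
    ... | no _   | no ⊤≢⊤ = contradiction ≡.refl ⊤≢⊤

    on-∅ : θ ⊥ ≈ 1# - a * r
    on-∅ with T? (𝒮 ⊥) | ⊥ {n} ≟ˢ ⊤ | ⊥ {n} ≟ˢ ⊥
    ... | yes ⊥∈ | _       | _      = contradiction ⊥∈ ⊥∉
    ... | no _   | yes ⊥≡⊤ | _      = contradiction ⊥≡⊤ ⊥≢⊤
    ... | no _   | no _    | yes _  = ≈-refl
    ... | no _   | no _    | no ⊥≢⊥ = contradiction ≡.refl ⊥≢⊥

    elsewhere : ∀ L → ¬ (L ∈ₛ 𝒮) → L ≢ ⊤ → L ≢ ⊥ → θ L ≈ 0#
    elsewhere L L∉ L≢⊤ L≢⊥ with T? (𝒮 L) | L ≟ˢ ⊤ | L ≟ˢ ⊥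
    ... | yes L∈ | _       | _       = contradiction L∈ L∉
    ... | no _   | yes L≡⊤ | _       = contradiction L≡⊤ L≢⊤
    ... | no _   | no _    | yes L≡⊥ = contradiction L≡⊥ L≢⊥
    ... | no _   | no _    | no _    = ≈-refl

  Θ-unique : MinSemiBalanced 𝒮 → ∀ {θ η} → θ ∈ Θ 𝒮 → η ∈ Θ 𝒮 → η ≋ θ
  Θ-unique {𝒮} min@((((S₀ , S₀∈) , ⊥∉ , _) , _) , _) {θ} {η}
    (c , r , c-affine , c-semiConic , c-yields , θ-assigned)
    (d , s , d-affine , d-semiConic , d-yields , η-assigned) = η≋θ
    where
    module θ = AssignedTo θ-assigned
    module η = AssignedTo η-assigned

    d≈c : ∀ S → S ∈ₛ 𝒮 → d S ≈ c S
    d≈c = affine-unique min c-affine c-semiConic c-yields d-affine d-semiConic d-yields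

    s≈r : s ≈ r
    -- A nonempty member provides a coordinate at which the constants can be compared.
    s≈r with ≢⊥⇒inside S₀ (λ S₀≡⊥ → ⊥∉ (subst (_∈ₛ 𝒮) S₀≡⊥ S₀∈))
    ... | i , _ = begin
      s                   ≈⟨ d-yields i ⟨
      combination 𝒮 d i   ≈⟨ sumOver-cong 𝒮 (λ S S∈ → *-congʳ (d≈c S S∈)) ⟩
      combination 𝒮 c i   ≈⟨ c-yields i ⟩
      r                   ∎

    η≋θ : η ≋ θ
    η≋θ L with T? (𝒮 L) | L ≟ˢ ⊤ | L ≟ˢ ⊥
    ... | yes L∈ | _ | _ =
      ≈-trans (η.on-𝒮 L L∈) (≈-trans (-‿cong (d≈c L L∈)) (≈-sym (θ.on-𝒮 L L∈)))
    ... | no _ | yes ≡.refl | _ = ≈-trans η.on-N (≈-trans s≈r (≈-sym θ.on-N))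
    ... | no _ | no _ | yes ≡.refl =
      ≈-trans η.on-∅ (≈-trans (+-congˡ (-‿cong s≈r)) (≈-sym θ.on-∅))
    ... | no L∉ | no L≢⊤ | no L≢⊥ =
      ≈-trans (η.elsewhere L L∉ L≢⊤ L≢⊥) (≈-sym (θ.elsewhere L L∉ L≢⊤ L≢⊥))

-- Exact games and the anti-dual involution.

module ExactGames (ℝ : CompleteOrderedField) (n : ℕ) where
  open CompleteOrderedField ℝ
    hiding (Carrier; _≈_; _≤_; _<_; _+_; _*_; _-_; -_; 0#; 1#)
  open OrderedField ℝ
  open PowersetSums ℝ
  open Games ℝ n
  open import Algebra.Properties.Semiring.Sum semiring
    using (sum-cong-≋; ∑-distrib-+; sum-replicate-zero)
  open import Relation.Binary.Reasoning.Setoid setoid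

  infix 8 _†
  -- The anti-dual, that is, the negative of the dual game `m ⊤ - m (∁ L)`. Dualising turns lower
  -- core bounds into upper ones; the sign makes them lower bounds for the negated vectors.
  _† : ℝᴾ → ℝᴾ
  (m †) L = m (∁ L) - m ⊤

  †-game : ∀ m → Game (m †)
  †-game m = ≈-trans (+-congʳ (reflexive (cong m (∁⊥≡⊤ n)))) (-‿inverseʳ (m ⊤))

  †-⊤ : ∀ m → Game m → (m †) ⊤ ≈ - m ⊤
  †-⊤ m m∅≈0 = ≈-trans
    (+-congʳ (≈-trans (reflexive (cong m (∁⊤≡⊥ n))) m∅≈0)) (+-identityˡ (- m ⊤))

  -- Two applications subtract `m ⊤` and then `(m †) ⊤`, which is `- m ⊤` because `m ⊥` is zero.
  †-involutive : ∀ m → Game m → m † † ≋ m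
  †-involutive m m∅≈0 L = begin
    (m †) (∁ L) - (m †) ⊤         ≈⟨ +-congˡ (-‿cong (†-⊤ m m∅≈0)) ⟩
    (m †) (∁ L) - - m ⊤           ≈⟨ +-congˡ (-‿involutive (m ⊤)) ⟩
    m (∁ (∁ L)) - m ⊤ + m ⊤       ≈⟨ x-y+y≈x (m (∁ (∁ L))) (m ⊤) ⟩
    m (∁ (∁ L))                   ≈⟨ reflexive (cong m (∁-involutive L)) ⟩
    m L                           ∎

  total-neg : ∀ x S → total (λ i → - x i) S ≈ total x (∁ S) - sum x
  total-neg x S = x+y≈z⇒x≈z-y (begin
    total (λ i → - x i) S + sum x
      ≈⟨ ∑-distrib-+ (λ i → if lookup S i then - x i else 0#) x ⟨
    sum (λ i → (if lookup S i then - x i else 0#) + x i)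
      ≈⟨ sum-cong-≋ pointwise ⟩
    total x (∁ S) ∎)
    where
    pointwise : ∀ i → (if lookup S i then - x i else 0#) + x i ≈ (if lookup (∁ S) i then x i else 0#)
    pointwise i rewrite lookup-map i not S with lookup S i
    ... | true  = -‿inverseˡ (x i)
    ... | false = +-identityˡ (x i)

  sum-neg : ∀ {k} (x : Fin k → Carrier) → sum (λ i → - x i) ≈ - sum x
  sum-neg {k} x = ≈-trans (x+y≈z⇒x≈z-y (begin
    sum (λ i → - x i) + sum x    ≈⟨ ∑-distrib-+ (λ i → - x i) x ⟨
    sum (λ i → - x i + x i)      ≈⟨ sum-cong-≋ (λ i → -‿inverseˡ (x i)) ⟩
    sum {k} (λ _ → 0#)           ≈⟨ sum-replicate-zero k ⟩
    0#                           ∎)) (+-identityˡ (- sum x))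

  -- The new bound at `S` is the old bound at `∁ S` with the equation for the grand total
  -- subtracted.
  †-core : ∀ m x → Game m → x ∈ Core m → (λ i → - x i) ∈ Core (m †)
  †-core m x m∅≈0 (sum≈ , m≤) =
    (≈-trans (sum-neg x) (≈-trans (-‿cong sum≈) (≈-sym (†-⊤ m m∅≈0)))) ,
    λ S → ≤-respʳ-≈ (≈-sym (≈-trans (total-neg x S) (+-congˡ (-‿cong sum≈))))
      (+-monoˡ-≤ (- m ⊤) (m≤ (∁ S)))

  -- A core vector tight at `∁ S` becomes tight at `S` when negated.
  †-exact : ∀ m → m ∈ Exact → m † ∈ Exact
  †-exact m (m∅≈0 , tight) = †-game m , λ S → tight† S (tight (∁ S))
    where
    tight† : ∀ S → ∃[ x ] (x ∈ Core m × total x (∁ S) ≈ m (∁ S)) →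
      ∃[ y ] (y ∈ Core (m †) × total y S ≈ (m †) S)
    tight† S (x , x∈ , x≈m) = (λ i → - x i) , †-core m x m∅≈0 x∈ ,
      ≈-trans (total-neg x S) (+-cong x≈m (-‿cong (proj₁ x∈)))

  -- Subtracting `m ⊤` everywhere changes the pairing by `m ⊤` times the sum of `θ`, which is zero;
  -- the rest is reindexing by complements. A separate `η` allows the roles of `θ` and its conjugate
  -- to be exchanged.
  pairing-† : ∀ {θ η} → ∑[ S ∈ allSubsets ] θ S ≈ 0# → η ≋ θ ⋆ᵛ →
    ∀ m → ⟨ θ , m † ⟩ ≈ ⟨ η , m ⟩
  pairing-† {θ} {η} Σθ≈0 η≋θ⋆ m = begin
    ⟨ θ , m † ⟩
      ≈⟨ sumPowerset-cong n (λ S → ≈-trans (distribˡ (θ S) (m (∁ S)) (- m ⊤))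
           (+-congˡ (*-comm (θ S) (- m ⊤)))) ⟩
    sumPowerset n (λ S → θ S * m (∁ S) + - m ⊤ * θ S)
      ≈⟨ sumPowerset-+ n _ _ ⟩
    sumPowerset n (λ S → θ S * m (∁ S)) + sumPowerset n (λ S → - m ⊤ * θ S)
      ≈⟨ +-congˡ (≈-trans (sumPowerset-*ˡ n (- m ⊤) θ) (≈-trans (*-congˡ Σθ≈0) (zeroʳ (- m ⊤)))) ⟩
    sumPowerset n (λ S → θ S * m (∁ S)) + 0#
      ≈⟨ +-identityʳ _ ⟩
    sumPowerset n (λ S → θ S * m (∁ S))
      ≈⟨ sumPowerset-cong n (λ S → *-congʳ (≈-trans
           (reflexive (cong θ (≡.sym (∁-involutive S)))) (≈-sym (η≋θ⋆ (∁ S))))) ⟩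
    sumPowerset n (λ S → η (∁ S) * m (∁ S))
      ≈⟨ sumPowerset-∁ n (λ S → η S * m S) ⟩
    ⟨ η , m ⟩ ∎

  -- Linearity of `†`, stated for arbitrary coefficients to cover both spanning (sum one) and affine
  -- independence (sum zero).
  †-combination : ∀ {k} v (p : Fin k → ℝᴾ) (c : Fin k → Carrier) → (∀ L → v L ≈ sum (λ i → c i * p i L)) →
    ∀ L → (v †) L ≈ sum (λ i → c i * (p i †) L)
  †-combination v p c v≈ L = ≈-sym (≈-trans
    (x+y≈z⇒x≈z-y (begin
      sum (λ i → c i * (p i †) L) + sum (λ i → c i * p i ⊤)
        ≈⟨ ∑-distrib-+ (λ i → c i * (p i †) L) (λ i → c i * p i ⊤) ⟨
      sum (λ i → c i * (p i †) L + c i * p i ⊤)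
        ≈⟨ sum-cong-≋ (λ i → ≈-trans (≈-sym (distribˡ (c i) _ _))
             (*-congˡ (x-y+y≈x (p i (∁ L)) (p i ⊤)))) ⟩
      sum (λ i → c i * p i (∁ L)) ∎))
    (≈-sym (+-cong (v≈ (∁ L)) (-‿cong (v≈ ⊤)))))

  combination-game : ∀ {k} v (p : Fin k → ℝᴾ) (c : Fin k → Carrier) → (∀ i → Game (p i)) →
    (∀ L → v L ≈ sum (λ i → c i * p i L)) → Game v
  combination-game {k} v p c p∅≈0 v≈ = ≈-trans (v≈ ⊥) (≈-trans
    (sum-cong-≋ (λ i → ≈-trans (*-congˡ (p∅≈0 i)) (zeroʳ (c i)))) (sum-replicate-zero k))

  affineHull-† : ∀ {X Y : Pred ℝᴾ 0ℓ} → (∀ m → m ∈ X → m † ∈ Y) →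
    ∀ v → v ∈ AffineHull X → v † ∈ AffineHull Y
  affineHull-† X⇒Y v (k , p , p∈X , c , sum≈1 , v≈) =
    k , (λ i → p i †) , (λ i → X⇒Y (p i) (p∈X i)) , c , sum≈1 , †-combination v p c v≈

  affineHull-game : ∀ {X : Pred ℝᴾ 0ℓ} → (∀ m → m ∈ X → Game m) →
    ∀ v → v ∈ AffineHull X → Game v
  affineHull-game X⇒Game v (k , p , p∈X , c , _ , v≈) =
    combination-game v p c (λ i → X⇒Game (p i) (p∈X i)) v≈

  -- On games `†` is a linear bijection inverse to itself, and affine hulls of sets of games consist
  -- of games, so an affine basis goes to an affine basis.
  hasDimension-† : ∀ {X Y : Pred ℝᴾ 0ℓ} →
    (∀ m → m ∈ X → Game m) → (∀ m → m ∈ Y → Game m) →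
    (∀ m → m ∈ X → m † ∈ Y) → (∀ m → m ∈ Y → m † ∈ X) →
    ∀ {d} → HasDimension X d → HasDimension Y d
  hasDimension-† {X} {Y} X⇒Game Y⇒Game X⇒Y Y⇒X {d} (p , p∈ , independent , spanning) =
    (λ i → p i †) , (λ i → affineHull-† {Y = Y} X⇒Y (p i) (p∈ i)) , independent† , spanning†
    where
    p-game : ∀ i → Game (p i)
    p-game i = affineHull-game X⇒Game (p i) (p∈ i)

    independent† : AffinelyIndependent (λ i → p i †)
    independent† c sum≈0 comb≈0 = independent c sum≈0 λ L → begin
      sum (λ i → c i * p i L)           ≈⟨ sum-cong-≋ (λ i → *-congˡ {c i} (†-involutive (p i) (p-game i) L)) ⟨
      -- The vanishing combination of the `p i †` is the zero vector, whose image under `†` is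
      -- `0# - 0#`.
      sum (λ i → c i * (p i † †) L)     ≈⟨ †-combination (λ _ → 0#) (λ i → p i †) c (λ K → ≈-sym (comb≈0 K)) L ⟨
      0# - 0#                           ≈⟨ -‿inverseʳ 0# ⟩
      0#                                ∎

    spanning† : ∀ v → v ∈ AffineHull Y → v ∈ AffineCombinationOf (λ i → p i †)
    -- `v †` is spanned by the `p i`, and a second `†` returns to `v`.
    spanning† v v∈ with spanning (v †) (affineHull-† {X = Y} {X} Y⇒X v v∈)
    ... | c , sum≈1 , v†≈ = c , sum≈1 , λ L → ≈-trans
      (≈-sym (†-involutive v (affineHull-game Y⇒Game v v∈) L)) (†-combination (v †) p c v†≈ L)

  -- `†` preserves exactness and turns one pairing into the other, so validity transfers and the two
  -- faces are exchanged; the dimension of the whole cone is carried over unchanged.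
  facetDefining-conjugate : ∀ {θ η} →
    ∑[ S ∈ allSubsets ] θ S ≈ 0# → ∑[ S ∈ allSubsets ] η S ≈ 0# →
    η ≋ θ ⋆ᵛ → θ ≋ η ⋆ᵛ → FacetDefining θ → FacetDefining η
  facetDefining-conjugate Σθ≈0 Ση≈0 η≋θ⋆ θ≋η⋆ (valid , d , dimExact , dimFace) =
    (λ m m∈ → ≤-respʳ-≈ (pairing-† Σθ≈0 η≋θ⋆ m) (valid (m †) (†-exact m m∈))) ,
    d , dimExact ,
    hasDimension-† (λ _ → proj₁ ∘ proj₁) (λ _ → proj₁ ∘ proj₁)
      (λ m (m∈ , θm≈0) → †-exact m m∈ , ≈-trans (pairing-† Ση≈0 θ≋η⋆ m) θm≈0)
      (λ m (m∈ , ηm≈0) → †-exact m m∈ , ≈-trans (pairing-† Σθ≈0 η≋θ⋆ m) ηm≈0)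
      dimFace

lemma11 : (ℝ : CompleteOrderedField) (n : ℕ) → 2 ≤ℕ n →
    let open Games ℝ n in
    ((𝒮 : SetSystem n) → NonTrivial 𝒮 →
    (SemiBalanced 𝒮 ⇔ SemiBalanced (𝒮 ⋆))
    × (∀ η → η ∈ Θ (𝒮 ⋆) ⇔ (∃[ θ ] (θ ∈ Θ 𝒮 × η ≋ θ ⋆ᵛ)))
    × (Balanced 𝒮 ⇔ Balanced (𝒮 ⋆))
    × (MinSemiBalanced 𝒮 ⇔ MinSemiBalanced (𝒮 ⋆))
    × (MinBalanced 𝒮 ⇔ MinBalanced (𝒮 ⋆))
    × (MinSemiBalanced 𝒮 →
    ∃[ θ ] (θ isOnlyElementOf Θ 𝒮 × θ ⋆ᵛ isOnlyElementOf Θ (𝒮 ⋆))))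
    × ((θ : ℝᴾ) →
    ∑[ S ∈ allSubsets ] θ S ≈ 0# →
    ∑[ L ∈ properSubsets ] θ L ≈ - 1# →
    FacetDefining θ ⇔ FacetDefining (θ ⋆ᵛ))
lemma11 ℝ n _ = setSystems , facets
  where
  open CompleteOrderedField ℝ using (≈-refl; ≈-sym; ≈-trans; reflexive)
  open PowersetSums ℝ using (sumPowerset-∁)
  open Games ℝ n
  open Combinations ℝ n
  open ExactGames ℝ n using (facetDefining-conjugate)

  conjugation-invariant : (P : Pred (SetSystem n) 0ℓ) →
    (∀ {𝒮 𝒯} → Conjugate 𝒮 𝒯 → P 𝒮 → P 𝒯) → ∀ 𝒮 → P 𝒮 ⇔ P (𝒮 ⋆)
  conjugation-invariant P P-conjugate 𝒮 =
    mk⇔ (P-conjugate (conjugate-⋆ 𝒮)) (P-conjugate (conjugate-sym (conjugate-⋆ 𝒮)))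

  ≋-⋆ᵛ-⋆ᵛ : ∀ (θ : ℝᴾ) → θ ≋ θ ⋆ᵛ ⋆ᵛ
  ≋-⋆ᵛ-⋆ᵛ θ L = reflexive (≡.sym (⋆ᵛ-involutive θ L))

  setSystems : (𝒮 : SetSystem n) → NonTrivial 𝒮 → _
  setSystems 𝒮 _ =
    conjugation-invariant SemiBalanced semiBalanced-conjugate 𝒮 ,
    (λ η → mk⇔
      -- Complementation is an involution, so the preimage of `η` is its own conjugate.
      (λ η∈ → η ⋆ᵛ , Θ-conjugate (conjugate-sym (conjugate-⋆ 𝒮)) η∈ , ≋-⋆ᵛ-⋆ᵛ η)
      (λ (θ , θ∈ , η≋θ⋆) → Θ-resp-≋ η≋θ⋆ (Θ-conjugate (conjugate-⋆ 𝒮) θ∈))) ,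
    conjugation-invariant Balanced balanced-conjugate 𝒮 ,
    conjugation-invariant MinSemiBalanced
      (minimal-conjugate SemiBalanced semiBalanced-conjugate) 𝒮 ,
    conjugation-invariant MinBalanced
      (minimal-conjugate Balanced balanced-conjugate) 𝒮 ,
    λ min → let θ , θ∈ = minSemiBalanced⇒Θ-satisfiable min in
      θ , (θ∈ , λ η η∈ → Θ-unique min θ∈ η∈) ,
      Θ-conjugate (conjugate-⋆ 𝒮) θ∈ ,
      λ η η∈ → Θ-unique
        (minimal-conjugate SemiBalanced semiBalanced-conjugate (conjugate-⋆ 𝒮) min)
        (Θ-conjugate (conjugate-⋆ 𝒮) θ∈) η∈

  facets : (θ : ℝᴾ) → ∑[ S ∈ allSubsets ] θ S ≈ 0# → ∑[ L ∈ properSubsets ] θ L ≈ - 1# →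
    FacetDefining θ ⇔ FacetDefining (θ ⋆ᵛ)
  facets θ Σθ≈0 _ = mk⇔
    (facetDefining-conjugate Σθ≈0 Σθ⋆≈0 (λ _ → ≈-refl) (≋-⋆ᵛ-⋆ᵛ θ))
    (facetDefining-conjugate Σθ⋆≈0 Σθ≈0 (≋-⋆ᵛ-⋆ᵛ θ) (λ _ → ≈-refl))
    where
    Σθ⋆≈0 : ∑[ S ∈ allSubsets ] (θ ⋆ᵛ) S ≈ 0#
    Σθ⋆≈0 = ≈-trans (sumPowerset-∁ n θ) Σθ≈0
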